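{- The integrality gap of $\textsc{Dir-MC-Rel}$ for $st$-Bi-Cut is $2$, even restricted to planar directed graphs. Precisely: (i) for every directed graph $G$ with non-negative edge weights and terminals $s,t$, the minimum weight of an $st$-bi-cut is at most $2\cdot\mathrm{LP}(G)$; and (ii) for every $\varepsilon>0$ there exists a planar directed graph $G$ with non-negative edge weights and terminals $s,t$ such that $\mathrm{LP}(G)>0$ and the minimum weight of an $st$-bi-cut in $G$ is at least $(2-\varepsilon)\,\mathrm{LP}(G)$.
   Context: For a directed graph $G=(V,E)$ with non-negative weights $w_e$ and two distinct terminals $s,t$, an $st$-bi-cut is a set $E'\subseteq E$ such that $G-E'$ has no directed path from $s$ to $t$ and no directed path from $t$ to $s$; its weight is $\sum_{e\in E'}w_e$. $\mathrm{LP}(G)$ is the optimum value of the LP: minimize $\sum_e w_ex_e$ subject to $\sum_{e\in p}x_e\ge1$ for every directed $s$–$t$ path $p$ and every directed $t$–$s$ path $p$, and $x_e\ge0$ for all $e$. -}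

module Defs where

open import Algebra.Bundles using (CommutativeRing)
open import Algebra.Definitions.RawMonoid using () renaming (_×_ to multiple; sum to ∑)
open import Data.Bool.Base using (if_then_else_)
open import Data.Fin.Base using (Fin; suc; inject₁)
open import Data.Fin.Subset using (Subset; _∉_)
open import Data.List.Base using (List; []; _∷_; map; foldr)
open import Data.List.Relation.Unary.All using (All)
open import Data.List.Relation.Unary.Unique.Propositional using (Unique)
open import Data.Nat.Base as ℕ using (ℕ)
open import Data.Product.Base using (Σ; ∃; _×_; _,_)
open import Data.Rational.Base as ℚ using (ℚ; 0ℚ; 1ℚ)
open import Data.Sum.Base using (_⊎_; [_,_])
open import Data.Vec.Base using (Vec; _∷_; _∷ʳ_; lookup)
open import Function.Definitions using (Injective)
open import Level using (Level; _⊔_) renaming (suc to lsuc)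
open import Relation.Binary.Core using (Rel)
open import Relation.Binary.Construct.Closure.ReflexiveTransitive using (Star; ε; _◅_)
open import Relation.Binary.PropositionalEquality.Core using (_≡_; _≢_)
open import Relation.Binary.Structures using (IsDecTotalOrder)
open import Relation.Nullary.Negation.Core using (¬_)

-- Stands in for ℝ: classically these are exactly the ordered subfields of ℝ,
-- with ℝ itself among them.
record ArchimedeanOrderedField (c ℓ₁ ℓ₂ : Level) : Set (lsuc (c ⊔ ℓ₁ ⊔ ℓ₂)) where
  infix 4 _≤_ _<_
  field
    commutativeRing : CommutativeRing c ℓ₁

  open CommutativeRing commutativeRing public

  field
    0≉1             : ¬ (0# ≈ 1#)
    inverse         : ∀ x → ¬ (x ≈ 0#) → ∃ λ y → x * y ≈ 1#
    _≤_             : Rel Carrier ℓ₂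
    isDecTotalOrder : IsDecTotalOrder _≈_ _≤_
    +-monoˡ-≤       : ∀ z {x y} → x ≤ y → x + z ≤ y + z
    *-nonneg        : ∀ {x y} → 0# ≤ x → 0# ≤ y → 0# ≤ x * y
    archimedean     : ∀ x → ∃ λ (n : ℕ) → x ≤ multiple +-rawMonoid n 1#

  _<_ : Rel Carrier (ℓ₁ ⊔ ℓ₂)
  x < y = x ≤ y × ¬ (x ≈ y)

  2# : Carrier
  2# = 1# + 1#

-- The edge set is a subset of V × V, enumerated without repetition.
record Digraph : Set where
  field
    #V #E       : ℕ
    src tgt     : Fin #E → Fin #V
    no-parallel : ∀ {e f} → src e ≡ src f → tgt e ≡ tgt f → e ≡ f

  V E : Set
  V = Fin #V
  E = Fin #E

  Arc : Rel V _
  Arc u v = Σ E λ e → src e ≡ u × tgt e ≡ v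

  Walk : Rel V _
  Walk = Star Arc

  edges : ∀ {u v} → Walk u v → List E
  edges ε             = []
  edges ((e , _) ◅ p) = e ∷ edges p

  vertices : ∀ {u v} → Walk u v → List V
  vertices {u} ε       = u ∷ []
  vertices {u} (_ ◅ p) = u ∷ vertices p

  IsPath : ∀ {u v} → Walk u v → Set
  IsPath p = Unique (vertices p)

  -- Paths of G - E′ are the paths of G none of whose edges lie in E′.
  Disconnects : Subset #E → V → V → Set
  Disconnects E′ u v = (p : Walk u v) → IsPath p → ¬ All (_∉ E′) (edges p)

  IsBiCut : V → V → Subset #E → Set
  IsBiCut s t E′ = Disconnects E′ s t × Disconnects E′ t s

Point : Set
Point = ℚ × ℚ

OnSegment : Point → Point × Point → Set
OnSegment (x , y) ((x₀ , y₀) , (x₁ , y₁)) = ∃ λ (r : ℚ) →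
  0ℚ ℚ.≤ r × r ℚ.≤ 1ℚ ×
  x ≡ x₀ ℚ.+ r ℚ.* (x₁ ℚ.- x₀) × y ≡ y₀ ℚ.+ r ℚ.* (y₁ ℚ.- y₀)

IsEndOf : Point → Point × Point → Set
IsEndOf p (a , b) = p ≡ a ⊎ p ≡ b

-- A crossing-free drawing in the plane in which every edge is a polygonal arc
-- with finitely many bends.  Polygonal arcs with rational coordinates suffice
-- for every finite graph that can be drawn in ℝ² with arbitrary continuous
-- arcs.  Orientations play no role, and antiparallel edges get separate arcs.
record PlaneDrawing (G : Digraph) : Set where
  open Digraph G
  field
    position : V → Point
    #bends   : E → ℕ
    bends    : ∀ e → Vec Point (#bends e)

  Node : Set
  Node = V ⊎ (Σ E λ e → Fin (#bends e))

  nodePosition : Node → Point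
  nodePosition = [ position , (λ (e , i) → lookup (bends e) i) ]

  polyline : ∀ e → Vec Point (ℕ.suc (ℕ.suc (#bends e)))
  polyline e = position (src e) ∷ (bends e ∷ʳ position (tgt e))

  Segment : Set
  Segment = Σ E λ e → Fin (ℕ.suc (#bends e))

  ends : Segment → Point × Point
  ends (e , i) = lookup (polyline e) (inject₁ i) , lookup (polyline e) (suc i)

  field
    nodes-distinct       : Injective _≡_ _≡_ nodePosition
    vertices-avoid       : ∀ v σ → OnSegment (position v) (ends σ) →
                           IsEndOf (position v) (ends σ)
    -- Since nodes are distinct points, a common end of two segments is a
    -- common vertex of their edges or the bend between them on one edge.
    segments-noncrossing : ∀ {σ τ} → σ ≢ τ → ∀ p →
                           OnSegment p (ends σ) → OnSegment p (ends τ) →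
                           IsEndOf p (ends σ) × IsEndOf p (ends τ)

Planar : Digraph → Set
Planar G = PlaneDrawing G

module _ {c ℓ₁ ℓ₂} (K : ArchimedeanOrderedField c ℓ₁ ℓ₂) where
  open ArchimedeanOrderedField K

  record Instance : Set (c ⊔ ℓ₂) where
    field
      graph : Digraph
    open Digraph graph public
    field
      w     : E → Carrier
      w≥0   : ∀ e → 0# ≤ w e
      s t   : V
      s≢t   : s ≢ t

  IsMinimum : ∀ {a p} {A : Set a} → (A → Set p) → (A → Carrier) → Carrier → Set (a ⊔ p ⊔ ℓ₁ ⊔ ℓ₂)
  IsMinimum P f m = (∃ λ a → P a × f a ≈ m) × (∀ a → P a → m ≤ f a)

  module _ (I : Instance) where
    open Instance I

    cutWeight : Subset #E → Carrier
    cutWeight E′ = ∑ +-rawMonoid (λ e → if lookup E′ e then w e else 0#)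

    IsMinBiCutWeight : Carrier → Set (ℓ₁ ⊔ ℓ₂)
    IsMinBiCutWeight = IsMinimum (IsBiCut s t) cutWeight

    pathLength : ∀ {u v} → (E → Carrier) → Walk u v → Carrier
    pathLength x p = foldr _+_ 0# (map x (edges p))

    Feasible : (E → Carrier) → Set ℓ₂
    Feasible x = (∀ e → 0# ≤ x e)
               × ((p : Walk s t) → IsPath p → 1# ≤ pathLength x p)
               × ((p : Walk t s) → IsPath p → 1# ≤ pathLength x p)

    objective : (E → Carrier) → Carrier
    objective x = ∑ +-rawMonoid (λ e → w e * x e)

    IsLPValue : Carrier → Set (c ⊔ ℓ₁ ⊔ ℓ₂)
    IsLPValue = IsMinimum Feasible objective

{-# OPTIONS --safe #-}
-- Upper bound: a fractional solution x gives a distance d from s with d(t) ≥ 1,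
-- and some threshold cut of d weighs at most Σ w x.  The union of such a cut for
-- s → t with one for t → s is a bi-cut of weight at most twice the LP value.
--
-- Lower bound: the vertices are the points (i , j) of the square 0 ≤ i , j ≤ k,
-- with s = (0 , k) and t = (k , 0).  The diagonal edges (i , j) → (i+1 , j+1)
-- have weight 1; the edges one step to the left or down are too heavy to be cut.
-- Every s-t path takes k diagonal edges to raise i, every t-s path k of them to
-- raise j, so giving each diagonal edge length 1/k shows that the LP value is at
-- most k.  The vertices S reachable from s after removing a bi-cut form a region
-- closed under left and down steps.  In each row some cut diagonal edge is
-- `outer`, i.e. starts at the last vertex of that row inside S; and each column
-- but one (where S leaves row 0) contains a cut diagonal edge that is not outer.
-- Hence a bi-cut has at least k + (k - 1) edges.
module Submission where

open import Defs
open import Algebra.Properties.Group using (∙-cancelˡ)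
open import Data.Bool.Base using (Bool; true; false; if_then_else_; not; _∧_; _∨_)
open import Data.Bool.Properties using (∨-zeroʳ)
open import Data.Fin.Base as Fin using (Fin; zero; suc; inject₁; fromℕ; toℕ; _↑ˡ_; _↑ʳ_; combine; remQuot; splitAt)
open import Data.Fin.Induction using (<-weakInduction; >-weakInduction)
import Data.Fin.Properties as Fin
open import Data.Fin.Subset using (Subset; _∈_; _∉_)
open import Data.List.Base using (List; []; _∷_; map; foldr; allFin; filter; length)
open import Data.List.Membership.Propositional using (lose) renaming (_∈_ to _∈ˡ_)
open import Data.List.Membership.Propositional.Properties using (∈-filter⁺; ∈-allFin)
open import Data.List.Properties using (filter-notAll)
open import Data.List.Relation.Unary.All as All using (All; []; _∷_)
open import Data.List.Relation.Unary.All.Properties using (all-filter)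
open import Data.List.Relation.Unary.AllPairs.Core using ([]; _∷_)
open import Data.List.Relation.Unary.Any using (here; there; any?)
open import Data.Nat.Base as ℕ using (ℕ; zero; suc; s≤s)
import Data.Nat.Properties as ℕ
open import Data.Product.Base using (Σ; ∃; _×_; _,_; proj₁; proj₂; uncurry)
open import Data.Rational.Base as ℚ using (ℚ; 0ℚ; 1ℚ)
import Data.Rational.Properties as ℚ
import Data.Rational.Solver as ℚ
open import Data.Sum.Base using (_⊎_; inj₁; inj₂)
open import Data.Sum.Function.Propositional using (_⊎-↔_)
open import Data.Vec.Base using ([]; tabulate; lookup)
open import Data.Vec.Properties using (lookup∘tabulate; []=⇒lookup; lookup⇒[]=)
open import Function.Base using (_∘_; case_of_)
open import Function.Bundles using (_↔_; Inverse)
open import Function.Construct.Composition using (_↔-∘_)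
open import Relation.Binary.Bundles using (DecTotalOrder)
open import Relation.Binary.Construct.Closure.ReflexiveTransitive using (ε; _◅_; _◅◅_)
open import Relation.Binary.Definitions using (tri<; tri≈; tri>)
open import Relation.Binary.PropositionalEquality as ≡ using (_≡_; _≢_)
open import Relation.Binary.Structures using (IsDecTotalOrder)
open import Relation.Nullary using (¬_; Dec; yes; no; does; contradiction; ¬?)
open import Relation.Nullary.Decidable using (_×-dec_; dec-true; dec-false)


true≢false : true ≢ false
true≢false ()

-- Order arithmetic, finite sums and minima in an ordered field.

module OrderedField {c ℓ₁ ℓ₂} (K : ArchimedeanOrderedField c ℓ₁ ℓ₂) where
  open ArchimedeanOrderedField K hiding (zero)
  open IsDecTotalOrder isDecTotalOrder public
    using (total; _≤?_; antisym)
    renaming (refl to ≤-refl; reflexive to ≤-reflexive; trans to ≤-trans)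
  open import Algebra.Definitions.RawMonoid +-rawMonoid using () renaming (_×_ to _·_)
  open import Algebra.Properties.CommutativeMonoid.Sum +-commutativeMonoid
    using (sum; sum-cong-≋; sum-replicate; ∑-distrib-+; ∑-comm) public
  open import Algebra.Properties.Ring ring using (-‿distribˡ-*; -‿involutive)

  decTotalOrder : DecTotalOrder _ _ _
  decTotalOrder = record { isDecTotalOrder = isDecTotalOrder }

  open import Relation.Binary.Reasoning.PartialOrder (DecTotalOrder.poset decTotalOrder)

  +-mono-≤ : ∀ {x y u v} → x ≤ y → u ≤ v → x + u ≤ y + v
  +-mono-≤ {x} {y} {u} {v} x≤y u≤v = begin
    x + u  ≤⟨ +-monoˡ-≤ u x≤y ⟩
    y + u  ≈⟨ +-comm y u ⟩
    u + y  ≤⟨ +-monoˡ-≤ y u≤v ⟩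
    v + y  ≈⟨ +-comm v y ⟩
    y + v  ∎

  x+y-y≈x : ∀ x y → (x + y) - y ≈ x
  x+y-y≈x x y = trans (+-assoc x y (- y)) (trans (+-congˡ (-‿inverseʳ y)) (+-identityʳ x))

  x-y+y≈x : ∀ x y → (x - y) + y ≈ x
  x-y+y≈x x y = trans (+-assoc x (- y) y) (trans (+-congˡ (-‿inverseˡ y)) (+-identityʳ x))

  +-cancelʳ-≤ : ∀ z {x y} → x + z ≤ y + z → x ≤ y
  +-cancelʳ-≤ z {x} {y} x+z≤y+z = begin
    x            ≈⟨ x+y-y≈x x z ⟨
    (x + z) - z  ≤⟨ +-monoˡ-≤ (- z) x+z≤y+z ⟩
    (y + z) - z  ≈⟨ x+y-y≈x y z ⟩
    y            ∎

  x≤x+y : ∀ {x y} → 0# ≤ y → x ≤ x + y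
  x≤x+y {x} {y} 0≤y = begin
    x       ≈⟨ +-identityʳ x ⟨
    x + 0#  ≤⟨ +-mono-≤ ≤-refl 0≤y ⟩
    x + y   ∎

  y≤x+y : ∀ {x y} → 0# ≤ x → y ≤ x + y
  y≤x+y {x} {y} 0≤x = begin
    y       ≈⟨ +-identityˡ y ⟨
    0# + y  ≤⟨ +-monoˡ-≤ y 0≤x ⟩
    x + y   ∎

  +-nonneg : ∀ {x y} → 0# ≤ x → 0# ≤ y → 0# ≤ x + y
  +-nonneg 0≤x 0≤y = ≤-trans 0≤x (x≤x+y 0≤y)

  x≤y⇒0≤y-x : ∀ {x y} → x ≤ y → 0# ≤ y - x
  x≤y⇒0≤y-x {x} {y} x≤y = begin
    0#     ≈⟨ -‿inverseʳ x ⟨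
    x - x  ≤⟨ +-monoˡ-≤ (- x) x≤y ⟩
    y - x  ∎

  *-monoˡ-≤ : ∀ {x y z} → 0# ≤ z → x ≤ y → z * x ≤ z * y
  *-monoˡ-≤ {x} {y} {z} 0≤z x≤y = begin
    z * x                ≤⟨ y≤x+y (*-nonneg 0≤z (x≤y⇒0≤y-x x≤y)) ⟩
    z * (y - x) + z * x  ≈⟨ distribˡ z (y - x) x ⟨
    z * ((y - x) + x)    ≈⟨ *-congˡ (x-y+y≈x y x) ⟩
    z * y                ∎

  *-monoʳ-≤ : ∀ {x y z} → 0# ≤ z → x ≤ y → x * z ≤ y * z
  *-monoʳ-≤ {x} {y} {z} 0≤z x≤y = begin
    x * z  ≈⟨ *-comm x z ⟩
    z * x  ≤⟨ *-monoˡ-≤ 0≤z x≤y ⟩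
    z * y  ≈⟨ *-comm z y ⟩
    y * z  ∎

  -- Otherwise `- 1#` would be nonnegative, and so would its square, which is `1#`.
  0≤1 : 0# ≤ 1#
  0≤1 with total 0# 1#
  ... | inj₁ 0≤1 = 0≤1
  ... | inj₂ 1≤0 = begin
    0#           ≤⟨ *-nonneg 0≤-1 0≤-1 ⟩
    - 1# * - 1#  ≈⟨ -‿distribˡ-* 1# (- 1#) ⟨
    - (1# * - 1#) ≈⟨ -‿cong (*-identityˡ (- 1#)) ⟩
    - (- 1#)     ≈⟨ -‿involutive 1# ⟩
    1#           ∎
    where
    0≤-1 : 0# ≤ - 1#
    0≤-1 = ≤-trans (x≤y⇒0≤y-x 1≤0) (≤-reflexive (+-identityˡ (- 1#)))

  1≰0 : ¬ (1# ≤ 0#)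
  1≰0 1≤0 = 0≉1 (antisym 0≤1 1≤0)

  ≰⇒≥ : ∀ {x y} → ¬ (x ≤ y) → y ≤ x
  ≰⇒≥ {x} {y} x≰y with total x y
  ... | inj₁ x≤y = contradiction x≤y x≰y
  ... | inj₂ y≤x = y≤x

  n·1-nonneg : ∀ n → 0# ≤ n · 1#
  n·1-nonneg zero    = ≤-refl
  n·1-nonneg (suc n) = +-nonneg 0≤1 (n·1-nonneg n)

  n·x≈n·1*x : ∀ n x → n · x ≈ (n · 1#) * x
  n·x≈n·1*x zero    x = sym (zeroˡ x)
  n·x≈n·1*x (suc n) x = begin-equality
    x + n · x                ≈⟨ +-cong (*-identityˡ x) (sym (n·x≈n·1*x n x)) ⟨
    1# * x + (n · 1#) * x    ≈⟨ distribʳ x 1# (n · 1#) ⟨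
    (1# + n · 1#) * x        ∎

  if-nonneg : ∀ b {z} → 0# ≤ z → 0# ≤ (if b then z else 0#)
  if-nonneg true  0≤z = 0≤z
  if-nonneg false _   = ≤-refl

  ∑-mono : ∀ {n} {f g : Fin n → Carrier} → (∀ i → f i ≤ g i) → sum f ≤ sum g
  ∑-mono {zero}  f≤g = ≤-refl
  ∑-mono {suc n} f≤g = +-mono-≤ (f≤g zero) (∑-mono (f≤g ∘ suc))

  ∑-nonneg : ∀ {n} {f : Fin n → Carrier} → (∀ i → 0# ≤ f i) → 0# ≤ sum f
  ∑-nonneg {zero}  0≤f = ≤-refl
  ∑-nonneg {suc n} 0≤f = +-nonneg (0≤f zero) (∑-nonneg (0≤f ∘ suc))

  term≤∑ : ∀ {n} {f : Fin n → Carrier} → (∀ i → 0# ≤ f i) → ∀ i → f i ≤ sum f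
  term≤∑ 0≤f zero    = x≤x+y (∑-nonneg (0≤f ∘ suc))
  term≤∑ 0≤f (suc i) = ≤-trans (term≤∑ (0≤f ∘ suc) i) (y≤x+y (0≤f zero))

  ∑-*ˡ : ∀ {n} x (f : Fin n → Carrier) → sum (λ i → x * f i) ≈ x * sum f
  ∑-*ˡ {zero}  x f = sym (zeroʳ x)
  ∑-*ˡ {suc n} x f = trans (+-congˡ (∑-*ˡ x (f ∘ suc))) (sym (distribˡ x _ _))

  ∑-++ : ∀ m {n} (f : Fin (m ℕ.+ n) → Carrier) →
         sum f ≈ sum (λ i → f (i ↑ˡ n)) + sum (λ j → f (m ↑ʳ j))
  ∑-++ zero    f = sym (+-identityˡ _)
  ∑-++ (suc m) f = trans (+-congˡ (∑-++ m (f ∘ suc))) (sym (+-assoc _ _ _))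

  ∑-combine : ∀ m {n} (f : Fin (m ℕ.* n) → Carrier) →
              sum f ≈ sum (λ i → sum (λ j → f (combine {m} {n} i j)))
  ∑-combine zero        f = refl
  ∑-combine (suc m) {n} f = trans (∑-++ n f) (+-congˡ (∑-combine m (λ e → f (n ↑ʳ e))))

  infixl 7 _⊓_
  _⊓_ : Carrier → Carrier → Carrier
  x ⊓ y = case total x y of λ where
    (inj₁ _) → x
    (inj₂ _) → y

  x⊓y≤x : ∀ x y → x ⊓ y ≤ x
  x⊓y≤x x y with total x y
  ... | inj₁ _   = ≤-refl
  ... | inj₂ y≤x = y≤x

  x⊓y≤y : ∀ x y → x ⊓ y ≤ y
  x⊓y≤y x y with total x y
  ... | inj₁ x≤y = x≤y
  ... | inj₂ _   = ≤-refl

  ⊓-elim : ∀ {p} (P : Carrier → Set p) {x y} → P x → P y → P (x ⊓ y)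
  ⊓-elim P {x} {y} px py with total x y
  ... | inj₁ _ = px
  ... | inj₂ _ = py

  argmin : ∀ {a} {A : Set a} (f : A → Carrier) {xs : List A} {x} → x ∈ˡ xs →
           ∃ λ y → y ∈ˡ xs × All (λ z → f y ≤ f z) xs
  argmin f {x ∷ []}      _ = x , here ≡.refl , ≤-refl ∷ []
  argmin f {x ∷ y ∷ xs}  _ with argmin f {y ∷ xs} (here ≡.refl)
  ... | z , z∈ , z≤ with total (f x) (f z)
  ... | inj₁ x≤z = x , here ≡.refl , ≤-refl ∷ All.map (≤-trans x≤z) z≤
  ... | inj₂ z≤x = z , there z∈ , z≤x ∷ z≤

-- Walk lengths, potentials and cuts of a digraph.

module Cuts {c ℓ₁ ℓ₂} (K : ArchimedeanOrderedField c ℓ₁ ℓ₂) (G : Digraph) where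
  open ArchimedeanOrderedField K hiding (zero)
  open OrderedField K
  open Digraph G
  open import Relation.Binary.Reasoning.PartialOrder (DecTotalOrder.poset decTotalOrder)

  walkLength : ∀ {u v} → (E → Carrier) → Walk u v → Carrier
  walkLength x p = foldr _+_ 0# (map x (edges p))

  -- Dual feasibility for shortest paths: such a `d` certifies lower bounds on walk lengths.
  Potential : (E → Carrier) → (V → Carrier) → Set _
  Potential x d = ∀ e → d (tgt e) ≤ d (src e) + x e

  potential-walk : ∀ {x d} → Potential x d → ∀ {u v} (p : Walk u v) → d v ≤ d u + walkLength x p
  potential-walk pot ε = ≤-reflexive (sym (+-identityʳ _))
  potential-walk {x} {d} pot {u} {v} ((e , ≡.refl , ≡.refl) ◅ p) = begin
    d v                                       ≤⟨ potential-walk pot p ⟩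
    d (tgt e) + walkLength x p                ≤⟨ +-monoˡ-≤ _ (pot e) ⟩
    (d (src e) + x e) + walkLength x p        ≈⟨ +-assoc _ _ _ ⟩
    d (src e) + (x e + walkLength x p)        ∎

  walkLength-◅◅ : ∀ x {u v w} (p : Walk u v) (q : Walk v w) →
                  walkLength x (p ◅◅ q) ≈ walkLength x p + walkLength x q
  walkLength-◅◅ x ε       q = sym (+-identityˡ _)
  walkLength-◅◅ x (_ ◅ p) q = trans (+-congˡ (walkLength-◅◅ x p q)) (sym (+-assoc _ _ _))

  -- Loop erasure and shortest distances.

  module _ {x : E → Carrier} (0≤x : ∀ e → 0# ≤ x e) where

    suffix-from : ∀ {u v w} (p : Walk v w) → IsPath p → u ∈ˡ vertices p →
                  Σ (Walk u w) λ q → IsPath q × walkLength x q ≤ walkLength x p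
    suffix-from ε         simple        (here ≡.refl) = ε , simple , ≤-refl
    suffix-from p@(_ ◅ _) simple        (here ≡.refl) = p , simple , ≤-refl
    suffix-from ((e , _) ◅ p) (_ ∷ simple) (there u∈p) =
      let q , q-simple , q≤p = suffix-from p simple u∈p
      in q , q-simple , ≤-trans q≤p (y≤x+y (0≤x e))

    -- The LP constrains simple paths only, whereas the distances below are witnessed by walks.
    -- Cutting out loops bridges the two, and with nonnegative lengths it never makes a walk longer.
    loop-erase : ∀ {u v} (p : Walk u v) → Σ (Walk u v) λ q → IsPath q × walkLength x q ≤ walkLength x p
    loop-erase ε = ε , [] ∷ [] , ≤-refl
    loop-erase {u} (a@(e , _) ◅ p) with loop-erase p
    ... | q , simple , q≤p with any? (u Fin.≟_) (vertices q)
    ... | yes u∈q = let r , r-simple , r≤q = suffix-from q simple u∈q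
                    in r , r-simple , ≤-trans r≤q (≤-trans q≤p (y≤x+y (0≤x e)))
    ... | no  u∉q = a ◅ q , All.tabulate (λ { v∈q ≡.refl → u∉q v∈q }) ∷ simple , +-mono-≤ ≤-refl q≤p

    -- Distances are truncated at 1, the value of an absent edge: a walk need
    -- only witness those below 1.
    Witnessed : V → V → Carrier → Set _
    Witnessed u v a = 1# ≤ a ⊎ Σ (Walk u v) λ p → walkLength x p ≤ a

    Metric : (V → V → Carrier) → Set _
    Metric D = (∀ u v → 0# ≤ D u v) × (∀ u v → Witnessed u v (D u v))

    -- The triangle inequality with intermediate vertex `i`. It is not part of `Metric`: the rounds
    -- establish it for one intermediate vertex after another.
    Closed : (V → V → Carrier) → V → Set _
    Closed D i = ∀ u v → D u v ≤ D u i + D i v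

    Witnessed-trans : ∀ {u v w a b} → 0# ≤ a → 0# ≤ b →
                      Witnessed u v a → Witnessed v w b → Witnessed u w (a + b)
    Witnessed-trans 0≤a 0≤b (inj₁ 1≤a) _ = inj₁ (≤-trans 1≤a (x≤x+y 0≤b))
    Witnessed-trans 0≤a 0≤b (inj₂ _) (inj₁ 1≤b) = inj₁ (≤-trans 1≤b (y≤x+y 0≤a))
    Witnessed-trans 0≤a 0≤b (inj₂ (p , p≤a)) (inj₂ (q , q≤b)) =
      inj₂ (p ◅◅ q , ≤-trans (≤-reflexive (walkLength-◅◅ x p q)) (+-mono-≤ p≤a q≤b))

    -- One round of the Floyd–Warshall algorithm.
    relax : V → (V → V → Carrier) → V → V → Carrier
    relax k D u v = D u v ⊓ (D u k + D k v)

    relax-metric : ∀ k {D} → Metric D → Metric (relax k D)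
    relax-metric k (0≤D , wit) =
      (λ u v → ⊓-elim (0# ≤_) (0≤D u v) (+-nonneg (0≤D u k) (0≤D k v))) ,
      (λ u v → ⊓-elim (Witnessed u v) (wit u v) (Witnessed-trans (0≤D u k) (0≤D k v) (wit u k) (wit k v)))

    relax-≤ : ∀ k D u v → relax k D u v ≤ D u v
    relax-≤ k D u v = x⊓y≤x _ _

    -- Relaxing at `k` lowers neither `D u k` nor `D k v`, because a detour through `k` adds the
    -- nonnegative `D k k`.
    relax-closed : ∀ k {D} → Metric D → Closed (relax k D) k
    relax-closed k {D} (0≤D , _) u v = begin
      relax k D u v               ≤⟨ x⊓y≤y _ _ ⟩
      D u k + D k v               ≤⟨ +-mono-≤ to-k from-k ⟩
      relax k D u k + relax k D k v  ∎
      where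
      to-k : D u k ≤ relax k D u k
      to-k = ⊓-elim (D u k ≤_) ≤-refl (x≤x+y (0≤D k k))
      from-k : D k v ≤ relax k D k v
      from-k = ⊓-elim (D k v ≤_) ≤-refl (y≤x+y (0≤D k k))

    relax-preserves-closed : ∀ k {D} → Metric D → ∀ {i} → Closed D i → Closed (relax k D) i
    relax-preserves-closed k {D} (0≤D , _) {i} closed u v =
      ⊓-elim (λ a → relax k D u v ≤ a + relax k D i v)
        (⊓-elim (λ b → relax k D u v ≤ D u i + b) direct after)
        (⊓-elim (λ b → relax k D u v ≤ (D u k + D k i) + b) before both)
      where
      via-k : relax k D u v ≤ D u k + D k v
      via-k = x⊓y≤y _ _
      direct : relax k D u v ≤ D u i + D i v
      direct = ≤-trans (relax-≤ k D u v) (closed u v)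
      after : relax k D u v ≤ D u i + (D i k + D k v)
      after = begin
        relax k D u v            ≤⟨ via-k ⟩
        D u k + D k v            ≤⟨ +-monoˡ-≤ _ (closed u k) ⟩
        (D u i + D i k) + D k v  ≈⟨ +-assoc _ _ _ ⟩
        D u i + (D i k + D k v)  ∎
      before : relax k D u v ≤ (D u k + D k i) + D i v
      before = begin
        relax k D u v            ≤⟨ via-k ⟩
        D u k + D k v            ≤⟨ +-mono-≤ ≤-refl (closed k v) ⟩
        D u k + (D k i + D i v)  ≈⟨ +-assoc _ _ _ ⟨
        (D u k + D k i) + D i v  ∎
      both : relax k D u v ≤ (D u k + D k i) + (D i k + D k v)
      both = ≤-trans via-k (+-mono-≤ (x≤x+y (0≤D k i)) (y≤x+y (0≤D i k)))

    -- The disjunction carries the vertices treated in earlier rounds through the recursion. With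
    -- all vertices in `ks`, the result satisfies the full triangle inequality.
    close : ∀ (ks : List V) {D} → Metric D → ∃ λ D′ →
            Metric D′ × (∀ u v → D′ u v ≤ D u v) × (∀ {i} → Closed D i ⊎ i ∈ˡ ks → Closed D′ i)
    close []       {D} metric = D , metric , (λ _ _ → ≤-refl) , λ { (inj₁ closed) → closed ; (inj₂ ()) }
    close (k ∷ ks) {D} metric with close ks (relax-metric k metric)
    ... | D′ , metric′ , D′≤ , closed′ = D′ , metric′ , (λ u v → ≤-trans (D′≤ u v) (relax-≤ k D u v)) , λ where
      (inj₁ closed)        → closed′ (inj₁ (relax-preserves-closed k metric closed))
      (inj₂ (here ≡.refl)) → closed′ (inj₁ (relax-closed k metric))
      (inj₂ (there i∈ks))  → closed′ (inj₂ i∈ks)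

    arc? : ∀ u v → Dec (Arc u v)
    arc? u v = Fin.any? λ e → (src e Fin.≟ u) ×-dec (tgt e Fin.≟ v)

    direct : V → V → Carrier
    direct u v with u Fin.≟ v | arc? u v
    ... | yes _ | _           = 0#
    ... | no _  | yes (e , _) = x e
    ... | no _  | no _        = 1#

    direct-metric : Metric direct
    direct-metric = nonneg , witnessed
      where
      nonneg : ∀ u v → 0# ≤ direct u v
      nonneg u v with u Fin.≟ v | arc? u v
      ... | yes _ | _           = ≤-refl
      ... | no _  | yes (e , _) = 0≤x e
      ... | no _  | no _        = 0≤1
      witnessed : ∀ u v → Witnessed u v (direct u v)
      witnessed u v with u Fin.≟ v | arc? u v
      ... | yes ≡.refl | _     = inj₂ (ε , ≤-refl)
      ... | no _       | yes a = inj₂ (a ◅ ε , ≤-reflexive (+-identityʳ _))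
      ... | no _       | no _  = inj₁ ≤-refl

    direct-refl : ∀ u → direct u u ≤ 0#
    direct-refl u with u Fin.≟ u
    ... | yes _   = ≤-refl
    ... | no  u≢u = contradiction ≡.refl u≢u

    direct-edge : ∀ e → direct (src e) (tgt e) ≤ x e
    direct-edge e with src e Fin.≟ tgt e | arc? (src e) (tgt e)
    ... | yes _ | _                   = 0≤x e
    -- The arc `f` found by the search need not be `e` by construction; `no-parallel` identifies
    -- them.
    ... | no _  | yes (f , src≡ , tgt≡) = ≤-reflexive (reflexive (≡.cong x (no-parallel src≡ tgt≡)))
    ... | no _  | no ¬a               = contradiction (e , ≡.refl , ≡.refl) ¬a

    -- The potential is the truncated distance from `s`, and the triangle inequality at the tail of
    -- an edge gives the potential condition. The value at `t` is either at least 1 by truncation or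
    -- bounded below by a walk, whose loop erasure is a path of length at least 1.
    distance-potential : ∀ {s t} → ((p : Walk s t) → IsPath p → 1# ≤ walkLength x p) →
                         ∃ λ d → Potential x d × d s ≤ 0# × 1# ≤ d t
    distance-potential {s} {t} long with close (allFin #V) direct-metric
    ... | D , (0≤D , wit) , D≤ , closed =
      D s ,
      (λ e → ≤-trans (closed (inj₂ (∈-allFin _)) s (tgt e))
                     (+-mono-≤ ≤-refl (≤-trans (D≤ _ _) (direct-edge e)))) ,
      ≤-trans (D≤ s s) (direct-refl s) ,
      (case wit s t of λ where
        (inj₁ 1≤)        → 1≤
        (inj₂ (p , p≤)) → let q , simple , q≤p = loop-erase p
                          in ≤-trans (long q simple) (≤-trans q≤p p≤))

  -- Threshold rounding of a potential to a light cut.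

  leaves : (V → Bool) → E → Bool
  leaves S e = S (src e) ∧ not (S (tgt e))

  weightOf : (E → Carrier) → (E → Bool) → Carrier
  weightOf w C = sum (λ e → if C e then w e else 0#)

  record Separates (s t : V) (S : V → Bool) : Set where
    constructor separates
    field
      s∈S : S s ≡ true
      t∉S : S t ≡ false

  -- Removes one layer of the potential. Vertices above 0 are lowered by `a`, a lower bound on their
  -- values, and the edges leaving the remaining vertices are shortened by `a`. The potential
  -- condition survives, and the objective drops by exactly `a` times the weight of the layer's cut,
  -- a discrete coarea formula.
  module Shrink {x : E → Carrier} {d : V → Carrier} (0≤x : ∀ e → 0# ≤ x e) (pot : Potential x d)
                {a : Carrier} (0≤a : 0# ≤ a) (a≤ : ∀ {v} → ¬ (d v ≤ 0#) → a ≤ d v) where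

    low : V → Bool
    low v = does (d v ≤? 0#)

    d′ : V → Carrier
    d′ v = if low v then d v else d v - a

    x′ : E → Carrier
    x′ e = if leaves low e then x e - a else x e

    d′-low : ∀ {v} → d v ≤ 0# → d′ v ≈ d v
    d′-low {v} dv≤0 with d v ≤? 0#
    ... | yes _    = refl
    ... | no  dv≰0 = contradiction dv≤0 dv≰0

    d′-high : ∀ {v} → ¬ (d v ≤ 0#) → d′ v + a ≈ d v
    d′-high {v} dv≰0 with d v ≤? 0#
    ... | yes dv≤0 = contradiction dv≤0 dv≰0
    ... | no  _    = x-y+y≈x (d v) a

    x-over-boundary : ∀ e → d (src e) ≤ 0# → ¬ (d (tgt e) ≤ 0#) → a ≤ x e
    x-over-boundary e du≤0 dv≰0 = begin
      a                ≤⟨ a≤ dv≰0 ⟩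
      d (tgt e)        ≤⟨ pot e ⟩
      d (src e) + x e  ≤⟨ +-monoˡ-≤ _ du≤0 ⟩
      0# + x e         ≈⟨ +-identityˡ _ ⟩
      x e              ∎

    0≤x′ : ∀ e → 0# ≤ x′ e
    0≤x′ e with d (src e) ≤? 0# | d (tgt e) ≤? 0#
    ... | yes du≤0 | yes _    = 0≤x e
    ... | yes du≤0 | no  dv≰0 = x≤y⇒0≤y-x (x-over-boundary e du≤0 dv≰0)
    ... | no  _    | _        = 0≤x e

    pot′ : Potential x′ d′
    pot′ e with d (src e) ≤? 0# | d (tgt e) ≤? 0#
    ... | yes _ | yes _ = pot e
    ... | yes _ | no  _ = begin
      d (tgt e) - a          ≤⟨ +-monoˡ-≤ (- a) (pot e) ⟩
      (d (src e) + x e) - a  ≈⟨ +-assoc _ _ _ ⟩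
      d (src e) + (x e - a)  ∎
    -- An edge back into the low set keeps its length; its tail is still at or above 0 after the
    -- lowering.
    ... | no du≰0 | yes dv≤0 = begin
      d (tgt e)              ≤⟨ dv≤0 ⟩
      0#                     ≤⟨ +-nonneg (x≤y⇒0≤y-x (a≤ du≰0)) (0≤x e) ⟩
      (d (src e) - a) + x e  ∎
    ... | no _ | no _ = begin
      d (tgt e) - a            ≤⟨ +-monoˡ-≤ (- a) (pot e) ⟩
      (d (src e) + x e) - a    ≈⟨ +-assoc _ _ _ ⟩
      d (src e) + (x e - a)    ≈⟨ +-congˡ (+-comm _ _) ⟩
      d (src e) + (- a + x e)  ≈⟨ +-assoc _ _ _ ⟨
      (d (src e) - a) + x e    ∎

    objective-split : ∀ w → sum (λ e → w e * x e) ≈ sum (λ e → w e * x′ e) + a * weightOf w (leaves low)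
    objective-split w = begin-equality
      sum (λ e → w e * x e)
        ≈⟨ sum-cong-≋ pointwise ⟩
      sum (λ e → w e * x′ e + a * (if leaves low e then w e else 0#))
        ≈⟨ ∑-distrib-+ (λ e → w e * x′ e) (λ e → a * (if leaves low e then w e else 0#)) ⟩
      sum (λ e → w e * x′ e) + sum (λ e → a * (if leaves low e then w e else 0#))
        ≈⟨ +-congˡ (∑-*ˡ a λ e → if leaves low e then w e else 0#) ⟩
      sum (λ e → w e * x′ e) + a * weightOf w (leaves low) ∎
      where
      pointwise : ∀ e → w e * x e ≈ w e * x′ e + a * (if leaves low e then w e else 0#)
      pointwise e with leaves low e
      ... | false = sym (trans (+-congˡ (zeroʳ a)) (+-identityʳ _))
      ... | true  = begin-equality
        w e * x e                    ≈⟨ *-congˡ (x-y+y≈x (x e) a) ⟨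
        w e * ((x e - a) + a)        ≈⟨ distribˡ _ _ _ ⟩
        w e * (x e - a) + w e * a    ≈⟨ +-congˡ (*-comm (w e) a) ⟩
        w e * (x e - a) + a * w e    ∎

  weightOf-nonneg : ∀ {w} → (∀ e → 0# ≤ w e) → ∀ C → 0# ≤ weightOf w C
  weightOf-nonneg 0≤w C = ∑-nonneg λ e → if-nonneg (C e) (0≤w e)

  module _ {w : E → Carrier} (0≤w : ∀ e → 0# ≤ w e) where

    -- The threshold cuts of d, lowest threshold first; L lists the vertices
    -- above the current one.
    light-threshold-cut : ∀ n {x d} → (∀ e → 0# ≤ x e) → Potential x d →
      ∀ {s t} → d s ≤ 0# → ¬ (d t ≤ 0#) → (L : List V) → length L ℕ.< n →
      All (λ v → ¬ (d v ≤ 0#)) L → (∀ {v} → ¬ (d v ≤ 0#) → v ∈ˡ L) →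
      ∃ λ S → Separates s t S × d t * weightOf w (leaves S) ≤ sum (λ e → w e * x e)
    light-threshold-cut (suc n) {x} {d} 0≤x pot {s} {t} ds≤0 dt≰0 L (s≤s |L|≤n) L⇒high high⇒L
      with argmin d (high⇒L dt≰0)
    ... | m , m∈L , min = result
      where
      dm≰0 : ¬ (d m ≤ 0#)
      dm≰0 = All.lookup L⇒high m∈L

      -- The layer is as thick as possible: `m` attains the least value above 0.
      open Shrink {x} {d} 0≤x pot {d m} (≰⇒≥ dm≰0) (λ dv≰0 → All.lookup min (high⇒L dv≰0))

      W₀ : Carrier
      W₀ = weightOf w (leaves low)

      low-separates : Separates s t low
      low-separates = separates (dec-true (d s ≤? 0#) ds≤0) (dec-false (d t ≤? 0#) dt≰0)

      high? : ∀ v → Dec (¬ (d′ v ≤ 0#))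
      high? v = ¬? (d′ v ≤? 0#)

      high′⇒high : ∀ {v} → ¬ (d′ v ≤ 0#) → ¬ (d v ≤ 0#)
      high′⇒high d′v≰0 dv≤0 = d′v≰0 (≤-trans (≤-reflexive (d′-low dv≤0)) dv≤0)

      -- The minimiser `m` drops out of the list of high vertices, so the bound `n` on its length
      -- can decrease.
      d′m≤0 : d′ m ≤ 0#
      d′m≤0 = +-cancelʳ-≤ (d m) (≤-reflexive (trans (d′-high dm≰0) (sym (+-identityˡ _))))

      shorter : length (filter high? L) ℕ.< n
      shorter = ℕ.<-≤-trans (filter-notAll high? L (lose m∈L (λ d′m≰0 → d′m≰0 d′m≤0))) |L|≤n

      result : ∃ λ S → Separates s t S × d t * weightOf w (leaves S) ≤ sum (λ e → w e * x e)
      result with d′ t ≤? 0#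
      -- This layer already brings `t` down to 0, so `d t` is at most its thickness `d m` and the
      -- layer's own cut is light enough.
      ... | yes d′t≤0 = low , low-separates , (begin
        d t * W₀
          ≤⟨ *-monoʳ-≤ (weightOf-nonneg 0≤w _) dt≤dm ⟩
        d m * W₀
          ≤⟨ y≤x+y (∑-nonneg λ e → *-nonneg (0≤w e) (0≤x′ e)) ⟩
        sum (λ e → w e * x′ e) + d m * W₀
          ≈⟨ objective-split w ⟨
        sum (λ e → w e * x e) ∎)
        where
        dt≤dm : d t ≤ d m
        dt≤dm = begin
          d t         ≈⟨ d′-high dt≰0 ⟨
          d′ t + d m  ≤⟨ +-monoˡ-≤ (d m) d′t≤0 ⟩
          0# + d m    ≈⟨ +-identityˡ _ ⟩
          d m         ∎
      ... | no d′t≰0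
        with light-threshold-cut n 0≤x′ pot′ (≤-trans (≤-reflexive (d′-low ds≤0)) ds≤0) d′t≰0
               (filter high? L) shorter (all-filter high? L)
               (λ d′v≰0 → ∈-filter⁺ high? (high⇒L (high′⇒high d′v≰0)) d′v≰0)
      ... | S , S-separates , S-light = lighter (total W₀ (weightOf w (leaves S)))
        where
        -- The height `d t` splits into `d′ t`, paid for by the recursive cut, and `d m`, paid for
        -- by this layer. A weight that is at most both cut weights can therefore be charged for the
        -- whole height.
        combined : ∀ {W} → W ≤ W₀ → W ≤ weightOf w (leaves S) → d t * W ≤ sum (λ e → w e * x e)
        combined {W} W≤W₀ W≤WS = begin
          d t * W                            ≈⟨ *-congʳ (d′-high dt≰0) ⟨
          (d′ t + d m) * W                   ≈⟨ distribʳ W _ _ ⟩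
          d′ t * W + d m * W                 ≤⟨ +-mono-≤ (*-monoˡ-≤ (≰⇒≥ d′t≰0) W≤WS) (*-monoˡ-≤ (≰⇒≥ dm≰0) W≤W₀) ⟩
          d′ t * weightOf w (leaves S) + d m * W₀  ≤⟨ +-monoˡ-≤ _ S-light ⟩
          sum (λ e → w e * x′ e) + d m * W₀  ≈⟨ objective-split w ⟨
          sum (λ e → w e * x e)              ∎
        lighter : W₀ ≤ weightOf w (leaves S) ⊎ weightOf w (leaves S) ≤ W₀ →
                  ∃ λ S → Separates s t S × d t * weightOf w (leaves S) ≤ sum (λ e → w e * x e)
        lighter (inj₁ W₀≤WS) = low , low-separates , combined ≤-refl W₀≤WS
        lighter (inj₂ WS≤W₀) = S , S-separates , combined WS≤W₀ ≤-refl

    -- For a single direction no factor is lost: the threshold cut costs at most the objective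
    -- divided by `d t`, and `d t` is at least 1.
    fractional-to-cut : ∀ {x s t} → (∀ e → 0# ≤ x e) → ((p : Walk s t) → IsPath p → 1# ≤ walkLength x p) →
                        ∃ λ S → Separates s t S × weightOf w (leaves S) ≤ sum (λ e → w e * x e)
    fractional-to-cut {x} {s} {t} 0≤x long with distance-potential 0≤x long
    ... | d , pot , ds≤0 , 1≤dt
      with light-threshold-cut _ 0≤x pot ds≤0 (λ dt≤0 → 1≰0 (≤-trans 1≤dt dt≤0))
             (filter high? (allFin #V)) (ℕ.n<1+n _) (all-filter high? (allFin #V))
             (λ {v} dv≰0 → ∈-filter⁺ high? (∈-allFin v) dv≰0)
      where
      high? : ∀ v → Dec (¬ (d v ≤ 0#))
      high? v = ¬? (d v ≤? 0#)
    ... | S , S-separates , S-light = S , S-separates , (begin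
      weightOf w (leaves S)        ≈⟨ *-identityˡ _ ⟨
      1# * weightOf w (leaves S)   ≤⟨ *-monoʳ-≤ (weightOf-nonneg 0≤w _) 1≤dt ⟩
      d t * weightOf w (leaves S)  ≤⟨ S-light ⟩
      sum (λ e → w e * x e)        ∎)

  -- Disconnecting edge sets and the vertex sets they separate.

  module _ {E′ : Subset #E} where

    closed-walk : ∀ {S} → (∀ e → leaves S e ≡ true → e ∈ E′) → ∀ {u v} (p : Walk u v) →
                  All (_∉ E′) (edges p) → S u ≡ true → S v ≡ true
    closed-walk cut ε [] u∈S = u∈S
    closed-walk {S} cut ((e , ≡.refl , ≡.refl) ◅ p) (e∉E′ ∷ p-avoids) u∈S with S (tgt e) in eq
    ... | true  = closed-walk cut p p-avoids eq
    ... | false = contradiction (cut e (≡.cong₂ (λ b b′ → b ∧ not b′) u∈S eq)) e∉E′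

    cut-disconnects : ∀ {s t S} → Separates s t S → (∀ e → leaves S e ≡ true → e ∈ E′) → Disconnects E′ s t
    cut-disconnects (separates s∈S t∉S) cut p _ avoids =
      true≢false (≡.trans (≡.sym (closed-walk cut p avoids s∈S)) t∉S)

    private
      χ : E → Carrier
      χ e = if lookup E′ e then 1# else 0#

      0≤χ : ∀ e → 0# ≤ χ e
      0≤χ e = if-nonneg (lookup E′ e) 0≤1

      long-or-avoiding : ∀ {u v} (p : Walk u v) → 1# ≤ walkLength χ p ⊎ All (_∉ E′) (edges p)
      long-or-avoiding ε = inj₂ []
      long-or-avoiding ((e , _) ◅ p) with lookup E′ e in eq | long-or-avoiding p
      ... | true  | _           = inj₁ (x≤x+y (walk-nonneg p))
        where
        walk-nonneg : ∀ {u v} (p : Walk u v) → 0# ≤ walkLength χ p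
        walk-nonneg ε             = ≤-refl
        walk-nonneg ((e , _) ◅ p) = +-nonneg (0≤χ e) (walk-nonneg p)
      ... | false | inj₁ 1≤     = inj₁ (≤-trans 1≤ (y≤x+y ≤-refl))
      ... | false | inj₂ avoids = inj₂ ((λ e∈E′ → true≢false (≡.trans (≡.sym ([]=⇒lookup e∈E′)) eq)) ∷ avoids)

    -- The set of vertices at distance 0 from s, when the edges of E′ have
    -- length 1 and all others have length 0.
    disconnected-cut : ∀ {s t} → Disconnects E′ s t →
                       ∃ λ S → Separates s t S × (∀ e → leaves S e ≡ true → e ∈ E′)
    disconnected-cut {s} {t} disc with distance-potential 0≤χ long
      where
      long : (p : Walk s t) → IsPath p → 1# ≤ walkLength χ p
      long p simple with long-or-avoiding p
      ... | inj₁ 1≤     = 1≤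
      ... | inj₂ avoids = contradiction avoids (disc p simple)
    ... | d , pot , ds≤0 , 1≤dt =
      (λ v → does (d v ≤? 0#)) ,
      separates (dec-true (d s ≤? 0#) ds≤0) (dec-false (d t ≤? 0#) (λ dt≤0 → 1≰0 (≤-trans 1≤dt dt≤0))) ,
      boundary
      where
      boundary : ∀ e → leaves (λ v → does (d v ≤? 0#)) e ≡ true → e ∈ E′
      boundary e lv with d (src e) ≤? 0# | d (tgt e) ≤? 0# | lookup E′ e in eq | pot e
      ... | yes _    | no _    | true  | _     = lookup⇒[]= e E′ eq
      -- An edge outside `E′` has length 0, so the potential cannot rise above 0 along it.
      ... | yes du≤0 | no dv≰0 | false | dv≤du = contradiction (≤-trans dv≤du (+-nonpos du≤0)) dv≰0
        where
        +-nonpos : ∀ {y} → y ≤ 0# → y + 0# ≤ 0#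
        +-nonpos y≤0 = ≤-trans (≤-reflexive (+-identityʳ _)) y≤0
      boundary e () | yes _ | yes _ | _ | _
      boundary e () | no _  | _     | _ | _

-- The upper bound: a bi-cut from two one-way cuts.

module Rounding {c ℓ₁ ℓ₂} (K : ArchimedeanOrderedField c ℓ₁ ℓ₂) (I : Instance K) where
  open ArchimedeanOrderedField K
  open OrderedField K
  open Instance I
  open Cuts K graph
  open import Relation.Binary.Reasoning.PartialOrder (DecTotalOrder.poset decTotalOrder)

  module Union {S T : V → Bool} (S-sep : Separates s t S) (T-sep : Separates t s T) where

    E′ : Subset #E
    E′ = tabulate (λ e → leaves S e ∨ leaves T e)

    in-E′ : ∀ e → leaves S e ∨ leaves T e ≡ true → e ∈ E′
    in-E′ e e∈ = lookup⇒[]= e E′ (≡.trans (lookup∘tabulate _ e) e∈)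

    isBiCut : IsBiCut s t E′
    isBiCut =
      cut-disconnects {S = S} S-sep (λ e e∈S → in-E′ e (≡.cong (_∨ leaves T e) e∈S)) ,
      cut-disconnects {S = T} T-sep (λ e e∈T → in-E′ e (≡.trans (≡.cong (leaves S e ∨_) e∈T) (∨-zeroʳ _)))

    weight≤ : cutWeight K I E′ ≤ weightOf w (leaves S) + weightOf w (leaves T)
    weight≤ = ≤-trans (∑-mono pointwise) (≤-reflexive (∑-distrib-+ (term S) (term T)))
      where
      term : (V → Bool) → E → Carrier
      term S e = if leaves S e then w e else 0#
      union : ∀ b b′ {z} → 0# ≤ z → (if b ∨ b′ then z else 0#) ≤ (if b then z else 0#) + (if b′ then z else 0#)
      union true  true  0≤z = x≤x+y 0≤z
      union true  false 0≤z = x≤x+y ≤-refl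
      union false _     0≤z = y≤x+y ≤-refl
      pointwise : ∀ e → (if lookup E′ e then w e else 0#) ≤ term S e + term T e
      pointwise e = ≡.subst (λ b → (if b then w e else 0#) ≤ term S e + term T e)
                      (≡.sym (lookup∘tabulate (λ e → leaves S e ∨ leaves T e) e))
                      (union (leaves S e) (leaves T e) (w≥0 e))

  bicut≤2lp : ∀ {opt lp} → IsMinBiCutWeight K I opt → IsLPValue K I lp → opt ≤ 2# * lp
  bicut≤2lp {opt} {lp} (_ , opt≤) ((x , (0≤x , st-long , ts-long) , obj≈lp) , _) =
    let S , S-sep , S-light = fractional-to-cut {w} w≥0 {x} 0≤x st-long
        T , T-sep , T-light = fractional-to-cut {w} w≥0 {x} 0≤x ts-long
        open Union {S} {T} S-sep T-sep
    in begin
    opt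
      ≤⟨ opt≤ E′ isBiCut ⟩
    cutWeight K I E′
      ≤⟨ weight≤ ⟩
    weightOf w (leaves S) + weightOf w (leaves T)
      ≤⟨ +-mono-≤ S-light T-light ⟩
    objective K I x + objective K I x
      ≈⟨ +-cong obj≈lp obj≈lp ⟩
    lp + lp
      ≈⟨ +-cong (*-identityˡ lp) (*-identityˡ lp) ⟨
    1# * lp + 1# * lp
      ≈⟨ distribʳ lp 1# 1# ⟨
    2# * lp ∎

-- The grid digraph.

module Grid (k : ℕ) where

  Site : Set
  Site = Fin (suc k) × Fin (suc k)

  -- An index in `Fin k` belongs to a coordinate that the edge changes, one in `Fin (suc k)` to a
  -- coordinate that it keeps.
  GridEdge : Set
  GridEdge = (Fin k × Fin k) ⊎ (Fin k × Fin (suc k)) ⊎ (Fin (suc k) × Fin k)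

  pattern diag i j = inj₁ (i , j)
  pattern left i j = inj₂ (inj₁ (i , j))
  pattern down i j = inj₂ (inj₂ (i , j))

  tail head : GridEdge → Site
  tail (diag i j) = inject₁ i , inject₁ j
  tail (left i j) = suc i , j
  tail (down i j) = i , suc j
  head (diag i j) = suc i , suc j
  head (left i j) = inject₁ i , j
  head (down i j) = i , inject₁ j

  -- Diagonal edges are numbered first, so that a sum over all edges splits into the diagonal ones
  -- and the rest.
  #edges : ℕ
  #edges = k ℕ.* k ℕ.+ (k ℕ.* suc k ℕ.+ suc k ℕ.* k)

  edges↔ : Fin #edges ↔ GridEdge
  edges↔ = (Fin.*↔× ⊎-↔ ((Fin.*↔× ⊎-↔ Fin.*↔×) ↔-∘ Fin.+↔⊎)) ↔-∘ Fin.+↔⊎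

  decode : Fin #edges → GridEdge
  decode = Inverse.to edges↔

  encode : GridEdge → Fin #edges
  encode = Inverse.from edges↔

  decode-encode : ∀ g → decode (encode g) ≡ g
  decode-encode g = Inverse.inverseˡ edges↔ ≡.refl

  encode-decode : ∀ e → encode (decode e) ≡ e
  encode-decode e = Inverse.inverseʳ edges↔ ≡.refl

  decode-injective : ∀ {e f} → decode e ≡ decode f → e ≡ f
  decode-injective {e} {f} eq = ≡.trans (≡.sym (encode-decode e)) (≡.trans (≡.cong encode eq) (encode-decode f))

  vertex : Site → Fin (suc k ℕ.* suc k)
  vertex (i , j) = combine i j

  coords : Fin (suc k ℕ.* suc k) → Site
  coords = remQuot (suc k)

  coords-vertex : ∀ p → coords (vertex p) ≡ p
  coords-vertex (i , j) = Fin.remQuot-combine i j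

  vertex-injective : ∀ {p q} → vertex p ≡ vertex q → p ≡ q
  vertex-injective {p} {q} eq = ≡.trans (≡.sym (coords-vertex p)) (≡.trans (≡.cong coords eq) (coords-vertex q))

  suc≢inject₁ : ∀ {n} {i : Fin n} → suc i ≢ inject₁ i
  suc≢inject₁ {i = suc i} eq = suc≢inject₁ (Fin.suc-injective eq)

  -- A coordinate cannot both rise and fall along one edge. This tells diagonals, which raise both
  -- coordinates, from left and down edges, which lower one.
  no-antiparallel : ∀ {n} {i j : Fin n} → suc i ≡ inject₁ j → inject₁ i ≡ suc j → ∀ {a} {A : Set a} → A
  no-antiparallel {i = i} {j = suc j} p q with Fin.suc-injective p
  no-antiparallel {i = zero}  {suc j} p () | r
  no-antiparallel {i = suc i} {suc j} p q  | r = no-antiparallel r (Fin.suc-injective q)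

  edge-determined : ∀ g h → tail g ≡ tail h → head g ≡ head h → g ≡ h
  edge-determined (diag i j) (diag i′ j′) t≡ h≡ =
    ≡.cong₂ (λ i j → diag i j) (Fin.suc-injective (≡.cong proj₁ h≡)) (Fin.suc-injective (≡.cong proj₂ h≡))
  edge-determined (left i j) (left i′ j′) t≡ h≡ =
    ≡.cong₂ (λ i j → left i j) (Fin.suc-injective (≡.cong proj₁ t≡)) (≡.cong proj₂ h≡)
  edge-determined (down i j) (down i′ j′) t≡ h≡ =
    ≡.cong₂ (λ i j → down i j) (≡.cong proj₁ t≡) (Fin.suc-injective (≡.cong proj₂ t≡))
  edge-determined (diag i j) (left i′ j′) t≡ h≡ = no-antiparallel (≡.cong proj₁ h≡) (≡.cong proj₁ t≡)
  edge-determined (left i j) (diag i′ j′) t≡ h≡ = no-antiparallel (≡.cong proj₁ t≡) (≡.cong proj₁ h≡)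
  edge-determined (diag i j) (down i′ j′) t≡ h≡ = no-antiparallel (≡.cong proj₂ h≡) (≡.cong proj₂ t≡)
  edge-determined (down i j) (diag i′ j′) t≡ h≡ = no-antiparallel (≡.cong proj₂ t≡) (≡.cong proj₂ h≡)
  edge-determined (left i j) (down i′ j′) t≡ h≡ =
    contradiction (≡.trans (≡.cong proj₁ t≡) (≡.sym (≡.cong proj₁ h≡))) suc≢inject₁
  edge-determined (down i j) (left i′ j′) t≡ h≡ =
    contradiction (≡.trans (≡.sym (≡.cong proj₁ t≡)) (≡.cong proj₁ h≡)) suc≢inject₁

  grid : Digraph
  grid = record
    { #V = suc k ℕ.* suc k
    ; #E = #edges
    ; src = vertex ∘ tail ∘ decode
    ; tgt = vertex ∘ head ∘ decode
    ; no-parallel = λ {e} {f} src≡ tgt≡ → decode-injective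
        (edge-determined (decode e) (decode f) (vertex-injective src≡) (vertex-injective tgt≡))
    }

-- Boolean sequences.

isZero : ∀ {n} → Fin n → Bool
isZero zero    = true
isZero (suc _) = false

-- A discrete intermediate value theorem: the search stops at the first drop from true to false. In
-- the rows and columns of a staircase, where the true positions form an initial segment, this is
-- the last true position.
last-true : ∀ {n} (f : Fin (suc n) → Bool) {j} → f zero ≡ true → f j ≡ false →
            ∃ λ i → f (inject₁ i) ≡ true × f (suc i) ≡ false
last-true             f {zero}  f0 fj = contradiction (≡.trans (≡.sym f0) fj) true≢false
last-true {n = suc n} f {suc j} f0 fj with f (suc zero) in eq
... | false = zero , f0 , eq
... | true  = let i , p , q = last-true (f ∘ suc) eq fj in suc i , p , q

contrapositive : ∀ {a b} → (a ≡ true → b ≡ true) → b ≡ false → a ≡ false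
contrapositive {false} _   _       = ≡.refl
contrapositive {true}  a⇒b b≡false = contradiction (≡.trans (≡.sym (a⇒b ≡.refl)) b≡false) true≢false

-- Counting cut diagonal edges between staircases.

module Counting {c ℓ₁ ℓ₂} (K : ArchimedeanOrderedField c ℓ₁ ℓ₂) where
  open ArchimedeanOrderedField K hiding (zero)
  open OrderedField K
  open import Algebra.Definitions.RawMonoid +-rawMonoid using () renaming (_×_ to _·_)
  open import Algebra.Solver.Ring.NaturalCoefficients.Default commutativeSemiring using (solve; _:=_; _:+_)
  open import Relation.Binary.Reasoning.PartialOrder (DecTotalOrder.poset decTotalOrder)

  ind : Bool → Carrier
  ind b = if b then 1# else 0#

  ind-nonneg : ∀ b → 0# ≤ ind b
  ind-nonneg b = if-nonneg b 0≤1

  1≤ind : ∀ {b} → b ≡ true → 1# ≤ ind b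
  1≤ind ≡.refl = ≤-refl

  1≤∑ind : ∀ {n} (f : Fin n → Bool) {i} → f i ≡ true → 1# ≤ sum (λ i → ind (f i))
  1≤∑ind f {i} fi = ≤-trans (1≤ind fi) (term≤∑ {f = λ i → ind (f i)} (λ i → ind-nonneg (f i)) i)

  ∑-1≤ : ∀ {n} (f : Fin n → Carrier) → (∀ i → 1# ≤ f i) → n · 1# ≤ sum f
  ∑-1≤ {zero}  f 1≤f = ≤-refl
  ∑-1≤ {suc n} f 1≤f = +-mono-≤ (1≤f zero) (∑-1≤ (f ∘ suc) (1≤f ∘ suc))

  -- Amortised counting: a term `f i` may fall short of 1 by as much as `b` decreases at that index,
  -- and the shortfalls telescope.
  telescope : ∀ {n} (f : Fin n → Carrier) (b : Fin (suc n) → Carrier) →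
              (∀ i → 1# + b (suc i) ≤ f i + b (inject₁ i)) → n · 1# + b (fromℕ n) ≤ sum f + b zero
  telescope {zero}  f b step = ≤-refl
  telescope {suc n} f b step = begin
    (1# + n · 1#) + b (suc (fromℕ n))     ≈⟨ +-assoc _ _ _ ⟩
    1# + (n · 1# + b (suc (fromℕ n)))     ≤⟨ +-mono-≤ ≤-refl (telescope (f ∘ suc) (b ∘ suc) (step ∘ suc)) ⟩
    1# + (sum (f ∘ suc) + b (suc zero))   ≈⟨ solve 3 (λ o x y → o :+ (x :+ y) := x :+ (o :+ y)) refl _ _ _ ⟩
    sum (f ∘ suc) + (1# + b (suc zero))   ≤⟨ +-mono-≤ ≤-refl (step zero) ⟩
    sum (f ∘ suc) + (f zero + b zero)     ≈⟨ solve 3 (λ x y z → x :+ (y :+ z) := (y :+ x) :+ z) refl _ _ _ ⟩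
    (f zero + sum (f ∘ suc)) + b zero     ∎

  module _ {k : ℕ} (χ : Fin k → Fin k → Bool) where

    cells : Carrier
    cells = sum λ i → sum λ j → ind (χ i j)

    -- The shape of a set that is left only by cut edges when no left or down edge is cut; `χ i j`
    -- tells whether the diagonal of cell `(i , j)` is cut.
    record Staircase (S : Fin (suc k) → Fin (suc k) → Bool) : Set where
      field
        left-closed : ∀ i j → S (suc i) j ≡ true → S (inject₁ i) j ≡ true
        down-closed : ∀ i j → S i (suc j) ≡ true → S i (inject₁ j) ≡ true
        diag-cut    : ∀ i j → S (inject₁ i) (inject₁ j) ≡ true → S (suc i) (suc j) ≡ false → χ i j ≡ true

    module STCut {S} (stair : Staircase S) (s∈S : S zero (fromℕ k) ≡ true) (t∉S : S (fromℕ k) zero ≡ false) where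
      open Staircase stair

      outer : Fin k → Fin k → Bool
      outer i j = S (inject₁ i) (inject₁ j) ∧ not (S (suc i) (inject₁ j))

      -- Row `j` starts inside `S`, below `s`, and ends outside `S`, above `t`. Where it leaves `S`,
      -- the right neighbour is outside, hence so is the vertex above that neighbour, which is the
      -- head of the diagonal.
      outer-in-row : ∀ j → ∃ λ i → χ i j ∧ outer i j ≡ true
      outer-in-row j
        with i , p , q ← last-true (λ i → S i (inject₁ j)) {fromℕ k}
               (>-weakInduction (λ j → S zero j ≡ true) s∈S (down-closed zero) (inject₁ j))
               (<-weakInduction (λ j → S (fromℕ k) j ≡ false) t∉S
                  (λ j → contrapositive (down-closed (fromℕ k) j)) (inject₁ j))
        = i , ≡.cong₂ _∧_ (diag-cut i j p (contrapositive (down-closed (suc i) j) q))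
                          (≡.cong₂ (λ a b → a ∧ not b) p q)

      k≤outer : k · 1# ≤ sum λ i → sum λ j → ind (χ i j ∧ outer i j)
      k≤outer = ≤-trans
        (∑-1≤ _ λ j → 1≤∑ind (λ i → χ i j ∧ outer i j) (proj₂ (outer-in-row j)))
        (≤-reflexive (sym (∑-comm λ i j → ind (χ i j ∧ outer i j))))

      cells-split : cells ≈ (sum λ i → sum λ j → ind (χ i j ∧ outer i j)) +
                            (sum λ i → sum λ j → ind (χ i j ∧ not (outer i j)))
      cells-split = trans
        (sum-cong-≋ λ i → trans
          (sum-cong-≋ λ j → split (χ i j) (outer i j))
          (∑-distrib-+ (λ j → ind (χ i j ∧ outer i j)) (λ j → ind (χ i j ∧ not (outer i j)))))
        (∑-distrib-+ (λ i → sum λ j → ind (χ i j ∧ outer i j)) (λ i → sum λ j → ind (χ i j ∧ not (outer i j))))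
        where
        split : ∀ a b → ind a ≈ ind (a ∧ b) + ind (a ∧ not b)
        split true  true  = sym (+-identityʳ _)
        split true  false = sym (+-identityˡ _)
        split false _     = sym (+-identityˡ _)

      k≤cells : k · 1# ≤ cells
      k≤cells = begin
        k · 1#                                             ≤⟨ k≤outer ⟩
        (sum λ i → sum λ j → ind (χ i j ∧ outer i j))      ≤⟨ x≤x+y (∑-nonneg λ i → ∑-nonneg λ j → ind-nonneg (χ i j ∧ not (outer i j))) ⟩
        (sum λ i → sum λ j → ind (χ i j ∧ outer i j)) + _  ≈⟨ cells-split ⟨
        cells                                              ∎

      module TSCut {T} (stairT : Staircase T) (t∈T : T (fromℕ k) zero ≡ true) (s∉T : T zero (fromℕ k) ≡ false) where
        open Staircase stairT using () renaming (left-closed to leftT; diag-cut to diagT)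

        -- The same argument with the coordinates exchanged: column `i` starts inside `T`, to the
        -- left of `t`, and ends outside `T`, to the right of `s`.
        cut-in-column : ∀ i → ∃ λ j → χ i j ≡ true
        cut-in-column i
          with j , p , q ← last-true (T (inject₁ i)) {fromℕ k}
                 (>-weakInduction (λ i → T i zero ≡ true) t∈T (λ i → leftT i zero) (inject₁ i))
                 (<-weakInduction (λ i → T i (fromℕ k) ≡ false) s∉T
                    (λ i → contrapositive (leftT i (fromℕ k))) (inject₁ i))
          = j , diagT i j p (contrapositive (leftT i (suc j)) q)

        -- A column missing a non-outer cell is the one where S leaves row 0.
        inner-in-column : ∀ i → S (suc i) zero ≡ true ⊎ S (inject₁ i) zero ≡ false →
                          ∃ λ j → χ i j ∧ not (outer i j) ≡ true
        inner-in-column i _ with cut-in-column i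
        inner-in-column i _ | j , χij with outer i j in eq
        inner-in-column i _ | j , χij | false = j , ≡.cong₂ (λ a b → a ∧ not b) χij eq
        -- Column `i+1` starts inside `S` but is outside at height `j`, so it leaves `S` at some
        -- `j′`. The diagonal of cell `(i , j′)` is then cut, and it is not outer because the right
        -- neighbour of its tail lies in `S`.
        inner-in-column i (inj₁ p) | j , χij | true with S (inject₁ i) (inject₁ j) | S (suc i) (inject₁ j) in q
        ... | true | false
          with j′ , r , r′ ← last-true (S (suc i)) p q
          = j′ , ≡.cong₂ (λ a b → a ∧ not b)
                   (diag-cut i j′ (left-closed i (inject₁ j′) r) r′)
                   (≡.cong₂ (λ a b → a ∧ not b) (left-closed i (inject₁ j′) r) r)
        -- If the bottom of column `i` is outside `S`, so is the whole column, and no edge starting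
        -- there is outer.
        inner-in-column i (inj₂ p) | j , χij | true
          with S (inject₁ i) (inject₁ j)
             | <-weakInduction (λ j → S (inject₁ i) j ≡ false) p
                 (λ j → contrapositive (down-closed (inject₁ i) j)) (inject₁ j)
        ... | true | ()
        inner-in-column i (inj₂ p) | j , χij | true | false | _ with () ← eq

        2k≤cells+1 : k · 1# + k · 1# ≤ cells + 1#
        2k≤cells+1 = begin
          k · 1# + k · 1#
            ≤⟨ +-mono-≤ k≤outer (begin
                 k · 1#                      ≤⟨ x≤x+y (ind-nonneg (S (fromℕ k) zero)) ⟩
                 k · 1# + ind (S (fromℕ k) zero)
                   -- The amortising sequence indicates which vertices of row 0 lie in `S`; it drops
                   -- only where `S` leaves that row.
                   ≤⟨ telescope (λ i → sum λ j → ind (χ i j ∧ not (outer i j))) (λ i → ind (S i zero)) column ⟩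
                 inner + ind (S zero zero)   ≤⟨ +-mono-≤ ≤-refl (ind≤1 (S zero zero)) ⟩
                 inner + 1#                  ∎) ⟩
          (sum λ i → sum λ j → ind (χ i j ∧ outer i j)) + (inner + 1#)
            ≈⟨ +-assoc _ _ _ ⟨
          ((sum λ i → sum λ j → ind (χ i j ∧ outer i j)) + inner) + 1#
            ≈⟨ +-congʳ cells-split ⟨
          cells + 1# ∎
          where
          inner : Carrier
          inner = sum λ i → sum λ j → ind (χ i j ∧ not (outer i j))

          ind≤1 : ∀ b → ind b ≤ 1#
          ind≤1 true  = ≤-refl
          ind≤1 false = 0≤1

          column : ∀ i → 1# + ind (S (suc i) zero) ≤
                         (sum λ j → ind (χ i j ∧ not (outer i j))) + ind (S (inject₁ i) zero)
          column i with S (suc i) zero in p | S (inject₁ i) zero in q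
          ... | true  | true  = +-monoˡ-≤ _ (1≤∑ind (λ j → χ i j ∧ not (outer i j)) (proj₂ (inner-in-column i (inj₁ p))))
          ... | false | false = +-monoˡ-≤ _ (1≤∑ind (λ j → χ i j ∧ not (outer i j)) (proj₂ (inner-in-column i (inj₂ q))))
          ... | true  | false = contradiction (≡.trans (≡.sym (left-closed i zero p)) q) true≢false
          -- The exceptional column: it may contribute nothing, and the drop of the indicator pays
          -- for it.
          ... | false | true  = begin
            1# + 0#  ≈⟨ +-comm _ _ ⟩
            0# + 1#  ≤⟨ +-monoˡ-≤ 1# (∑-nonneg λ j → ind-nonneg (χ i j ∧ not (outer i j))) ⟩
            _ + 1#   ∎

-- The straight-line drawing of the grid.

-- Defined by recursion so that `ι (suc n)` unfolds to `ι n ℚ.+ 1ℚ`, the form in which the ring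
-- identities for segments apply.
ι : ℕ → ℚ
ι zero    = 0ℚ
ι (suc n) = ι n ℚ.+ 1ℚ

ι-gap : ∀ {m n} → m ℕ.< n → ι m ℚ.+ 1ℚ ℚ.≤ ι n
ι-gap {m} {suc n} (s≤s m≤n) with ℕ.m≤n⇒m<n∨m≡n m≤n
... | inj₂ ≡.refl = ℚ.≤-refl
... | inj₁ m<n    = ℚ.≤-trans (ι-gap m<n)
  (ℚ.≤-trans (ℚ.≤-reflexive (≡.sym (ℚ.+-identityʳ (ι n)))) (ℚ.+-monoʳ-≤ (ι n) (ℚ.nonNegative⁻¹ 1ℚ)))

Fraction : ℚ → Set
Fraction r = 0ℚ ℚ.≤ r × r ℚ.< 1ℚ

ι-separates : ∀ {m n r q} → Fraction r → Fraction q → m ℕ.< n → ι m ℚ.+ r ≢ ι n ℚ.+ q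
ι-separates {m} {n} {r} {q} (_ , r<1) (0≤q , _) m<n = ℚ.<⇒≢ (begin-strict
  ι m ℚ.+ r   <⟨ ℚ.+-monoʳ-< (ι m) r<1 ⟩
  ι m ℚ.+ 1ℚ  ≤⟨ ι-gap m<n ⟩
  ι n         ≡⟨ ℚ.+-identityʳ (ι n) ⟨
  ι n ℚ.+ 0ℚ  ≤⟨ ℚ.+-monoʳ-≤ (ι n) 0≤q ⟩
  ι n ℚ.+ q   ∎)
  where open ℚ.≤-Reasoning

-- Uniqueness of integer and fractional parts: unequal integer parts differ by at least 1, more than
-- fractional parts can make up for.
floor-unique : ∀ m n {r q} → Fraction r → Fraction q → ι m ℚ.+ r ≡ ι n ℚ.+ q → m ≡ n × r ≡ q
floor-unique m n {r} {q} fr fq eq with ℕ.<-cmp m n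
... | tri< m<n _ _    = contradiction eq (ι-separates fr fq m<n)
... | tri> _ _ n<m    = contradiction (≡.sym eq) (ι-separates fq fr n<m)
... | tri≈ _ ≡.refl _ = ≡.refl , ∙-cancelˡ ℚ.+-0-group (ι m) r q eq

fraction-0 : Fraction 0ℚ
fraction-0 = ℚ.≤-refl , ℚ.positive⁻¹ 1ℚ

module GridDrawing (k : ℕ) where
  open Grid k
  open ℚ.+-*-Solver using (solve; _:=_; _:+_; _:*_; _:-_; con)

  place : Site → Point
  place (i , j) = ι (toℕ i) , ι (toℕ j)

  -- The lower left end of an edge.
  corner : GridEdge → ℕ × ℕ
  corner (diag i j) = toℕ i , toℕ j
  corner (left i j) = toℕ i , toℕ j
  corner (down i j) = toℕ i , toℕ j

  -- Positions are measured from the lower left end, against the orientation of left and down edges,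
  -- so that both components are fractional parts.
  offset : GridEdge → ℚ → ℚ × ℚ
  offset (diag _ _) r = r , r
  offset (left _ _) r = r , 0ℚ
  offset (down _ _) r = 0ℚ , r

  Fractions : ℚ × ℚ → Set
  Fractions (r , q) = Fraction r × Fraction q

  _⊞_ : ℕ × ℕ → ℚ × ℚ → Point
  (m , n) ⊞ (r , q) = ι m ℚ.+ r , ι n ℚ.+ q

  ⊞-injective : ∀ c c′ {o o′} → Fractions o → Fractions o′ → c ⊞ o ≡ c′ ⊞ o′ → c ≡ c′ × o ≡ o′
  ⊞-injective (m , n) (m′ , n′) {_ , _} {_ , _} (fr , fq) (fr′ , fq′) eq
    with ≡.refl , ≡.refl ← floor-unique m m′ fr fr′ (≡.cong proj₁ eq)
       | ≡.refl , ≡.refl ← floor-unique n n′ fq fq′ (≡.cong proj₂ eq)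
    = ≡.refl , ≡.refl

  point : GridEdge → ℚ → Point
  point g r = corner g ⊞ offset g r

  Interior : GridEdge → Point → Set
  Interior g p = ∃ λ r → 0ℚ ℚ.< r × r ℚ.< 1ℚ × p ≡ point g r

  forward : ∀ a r → a ℚ.+ r ℚ.* ((a ℚ.+ 1ℚ) ℚ.- a) ≡ a ℚ.+ r
  forward = solve 2 (λ a r → a :+ r :* ((a :+ con 1ℚ) :- a) := a :+ r) ≡.refl

  backward : ∀ a r → (a ℚ.+ 1ℚ) ℚ.+ r ℚ.* (a ℚ.- (a ℚ.+ 1ℚ)) ≡ a ℚ.+ (1ℚ ℚ.- r)
  backward = solve 2 (λ a r → (a :+ con 1ℚ) :+ r :* (a :- (a :+ con 1ℚ)) := a :+ (con 1ℚ :- r)) ≡.refl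

  still : ∀ a r → a ℚ.+ r ℚ.* (a ℚ.- a) ≡ a ℚ.+ 0ℚ
  still = solve 2 (λ a r → a :+ r :* (a :- a) := a :+ con 0ℚ) ≡.refl

  at-start : ∀ a b → a ℚ.+ 0ℚ ℚ.* (b ℚ.- a) ≡ a
  at-start = solve 2 (λ a b → a :+ con 0ℚ :* (b :- a) := a) ≡.refl

  at-end : ∀ a b → a ℚ.+ 1ℚ ℚ.* (b ℚ.- a) ≡ b
  at-end = solve 2 (λ a b → a :+ con 1ℚ :* (b :- a) := b) ≡.refl

  on-edge : ∀ g {p} → OnSegment p (place (tail g) , place (head g)) →
            IsEndOf p (place (tail g) , place (head g)) ⊎ Interior g p
  on-edge g (r , 0≤r , r≤1 , x≡ , y≡) with r ℚ.≟ 0ℚ | r ℚ.≟ 1ℚ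
  ... | yes ≡.refl | _ = inj₁ (inj₁ (≡.cong₂ _,_ (≡.trans x≡ (at-start _ x₁)) (≡.trans y≡ (at-start _ y₁))))
    where
    x₁ = proj₁ (place (head g))
    y₁ = proj₂ (place (head g))
  ... | no _ | yes ≡.refl = inj₁ (inj₂ (≡.cong₂ _,_ (≡.trans x≡ (at-end x₀ _)) (≡.trans y≡ (at-end y₀ _))))
    where
    x₀ = proj₁ (place (tail g))
    y₀ = proj₂ (place (tail g))
  ... | no r≢0 | no r≢1 = inj₂ (interior g x≡ y≡)
    where
    0<r : 0ℚ ℚ.< r
    0<r = ℚ.≰⇒> λ r≤0 → r≢0 (ℚ.≤-antisym r≤0 0≤r)
    r<1 : r ℚ.< 1ℚ
    r<1 = ℚ.≰⇒> λ 1≤r → r≢1 (ℚ.≤-antisym r≤1 1≤r)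
    0<1-r : 0ℚ ℚ.< 1ℚ ℚ.- r
    0<1-r = ≡.subst (ℚ._< 1ℚ ℚ.- r) (ℚ.+-inverseʳ r) (ℚ.+-monoˡ-< (ℚ.- r) r<1)
    1-r<1 : 1ℚ ℚ.- r ℚ.< 1ℚ
    1-r<1 = ≡.subst (1ℚ ℚ.- r ℚ.<_) (ℚ.+-identityʳ 1ℚ) (ℚ.+-monoʳ-< 1ℚ (ℚ.neg-antimono-< 0<r))
    interior : ∀ g {p} →
      let (x₀ , y₀) = place (tail g) ; (x₁ , y₁) = place (head g) in
      proj₁ p ≡ x₀ ℚ.+ r ℚ.* (x₁ ℚ.- x₀) → proj₂ p ≡ y₀ ℚ.+ r ℚ.* (y₁ ℚ.- y₀) → Interior g p
    interior (diag i j) x≡ y≡ rewrite Fin.toℕ-inject₁ i | Fin.toℕ-inject₁ j =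
      r , 0<r , r<1 , ≡.cong₂ _,_ (≡.trans x≡ (forward (ι (toℕ i)) r)) (≡.trans y≡ (forward (ι (toℕ j)) r))
    -- Left and down edges start at their far end, so the segment parameter `r` turns into
    -- `1ℚ ℚ.- r`.
    interior (left i j) x≡ y≡ rewrite Fin.toℕ-inject₁ i =
      1ℚ ℚ.- r , 0<1-r , 1-r<1 , ≡.cong₂ _,_ (≡.trans x≡ (backward (ι (toℕ i)) r)) (≡.trans y≡ (still (ι (toℕ j)) r))
    interior (down i j) x≡ y≡ rewrite Fin.toℕ-inject₁ j =
      1ℚ ℚ.- r , 0<1-r , 1-r<1 , ≡.cong₂ _,_ (≡.trans x≡ (still (ι (toℕ i)) r)) (≡.trans y≡ (backward (ι (toℕ j)) r))

  offset-fractions : ∀ g {r} → 0ℚ ℚ.< r → r ℚ.< 1ℚ → Fractions (offset g r)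
  offset-fractions (diag _ _) 0<r r<1 = (ℚ.<⇒≤ 0<r , r<1) , (ℚ.<⇒≤ 0<r , r<1)
  offset-fractions (left _ _) 0<r r<1 = (ℚ.<⇒≤ 0<r , r<1) , fraction-0
  offset-fractions (down _ _) 0<r r<1 = fraction-0 , (ℚ.<⇒≤ 0<r , r<1)

  -- Both fractional parts of a vertex vanish, but never both of an interior point of an edge.
  place-not-interior : ∀ c g → ¬ Interior g (place c)
  place-not-interior (i , j) g (r , 0<r , r<1 , eq) = nonzero g
    (proj₂ (⊞-injective (toℕ i , toℕ j) (corner g) (fraction-0 , fraction-0) (offset-fractions g 0<r r<1)
      (≡.trans (≡.cong₂ _,_ (ℚ.+-identityʳ _) (ℚ.+-identityʳ _)) eq)))
    where
    nonzero : ∀ g → (0ℚ , 0ℚ) ≢ offset g r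
    nonzero (diag _ _) o≡ = ℚ.<⇒≢ 0<r (≡.cong proj₁ o≡)
    nonzero (left _ _) o≡ = ℚ.<⇒≢ 0<r (≡.cong proj₁ o≡)
    nonzero (down _ _) o≡ = ℚ.<⇒≢ 0<r (≡.cong proj₂ o≡)

  -- An interior point determines its edge: the integer parts give the corner, and which fractional
  -- parts vanish gives the kind of edge.
  interiors-disjoint : ∀ g h {p} → Interior g p → Interior h p → g ≡ h
  interiors-disjoint g h (r , 0<r , r<1 , eq) (q , 0<q , q<1 , eq′) =
    uncurry (same g h) (⊞-injective (corner g) (corner h) (offset-fractions g 0<r r<1) (offset-fractions h 0<q q<1)
                          (≡.trans (≡.sym eq) eq′))
    where
    corners : ∀ {m n} {A : Set} (f : Fin m → Fin n → A) {i i′ j j′} →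
              (toℕ i , toℕ j) ≡ (toℕ i′ , toℕ j′) → f i j ≡ f i′ j′
    corners f c≡ = ≡.cong₂ f (Fin.toℕ-injective (≡.cong proj₁ c≡)) (Fin.toℕ-injective (≡.cong proj₂ c≡))
    same : ∀ g h → corner g ≡ corner h → offset g r ≡ offset h q → g ≡ h
    same (diag _ _) (diag _ _) c≡ _ = corners (λ i j → diag i j) c≡
    same (left _ _) (left _ _) c≡ _ = corners (λ i j → left i j) c≡
    same (down _ _) (down _ _) c≡ _ = corners (λ i j → down i j) c≡
    same (diag _ _) (left _ _) _ o≡ = contradiction (≡.sym (≡.cong proj₂ o≡)) (ℚ.<⇒≢ 0<r)
    same (diag _ _) (down _ _) _ o≡ = contradiction (≡.sym (≡.cong proj₁ o≡)) (ℚ.<⇒≢ 0<r)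
    same (left _ _) (diag _ _) _ o≡ = contradiction (≡.cong proj₂ o≡) (ℚ.<⇒≢ 0<q)
    same (left _ _) (down _ _) _ o≡ = contradiction (≡.cong proj₂ o≡) (ℚ.<⇒≢ 0<q)
    same (down _ _) (diag _ _) _ o≡ = contradiction (≡.cong proj₁ o≡) (ℚ.<⇒≢ 0<q)
    same (down _ _) (left _ _) _ o≡ = contradiction (≡.cong proj₁ o≡) (ℚ.<⇒≢ 0<q)

  endpoint-not-interior : ∀ {c c′ p} g → IsEndOf p (place c , place c′) → ¬ Interior g p
  endpoint-not-interior {c}      g (inj₁ ≡.refl) = place-not-interior c g
  endpoint-not-interior {_} {c′} g (inj₂ ≡.refl) = place-not-interior c′ g

  edges-noncrossing : ∀ g h → g ≢ h → ∀ p →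
    OnSegment p (place (tail g) , place (head g)) → OnSegment p (place (tail h) , place (head h)) →
    IsEndOf p (place (tail g) , place (head g)) × IsEndOf p (place (tail h) , place (head h))
  edges-noncrossing g h g≢h p on-g on-h with on-edge g on-g | on-edge h on-h
  ... | inj₁ end-g | inj₁ end-h = end-g , end-h
  ... | inj₁ end-g | inj₂ int-h = contradiction int-h (endpoint-not-interior {tail g} {head g} h end-g)
  ... | inj₂ int-g | inj₁ end-h = contradiction int-g (endpoint-not-interior {tail h} {head h} g end-h)
  ... | inj₂ int-g | inj₂ int-h = contradiction (interiors-disjoint g h int-g int-h) g≢h

  place-injective : ∀ {c c′} → place c ≡ place c′ → c ≡ c′
  place-injective eq = ≡.cong₂ _,_ (ι-inj (≡.cong proj₁ eq)) (ι-inj (≡.cong proj₂ eq))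
    where
    ι-inj : ∀ {n} {i j : Fin n} → ι (toℕ i) ≡ ι (toℕ j) → i ≡ j
    ι-inj {_} {i} {j} eq = Fin.toℕ-injective (proj₁ (floor-unique (toℕ i) (toℕ j) fraction-0 fraction-0 (≡.cong (ℚ._+ 0ℚ) eq)))

  open Digraph grid using (V; E; src; tgt)

  position : V → Point
  position = place ∘ coords

  edge-ends : ∀ e → (position (src e) , position (tgt e)) ≡ (place (tail (decode e)) , place (head (decode e)))
  edge-ends e = ≡.cong₂ (λ c c′ → place c , place c′) (coords-vertex (tail (decode e))) (coords-vertex (head (decode e)))

  position-injective : ∀ {u v} → position u ≡ position v → u ≡ v
  position-injective {u} {v} eq =
    ≡.trans (≡.sym (Fin.combine-remQuot (suc k) u))
      (≡.trans (≡.cong vertex (place-injective {coords u} {coords v} eq)) (Fin.combine-remQuot (suc k) v))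

  grid-planar : Planar grid
  grid-planar = record
    { position             = position
    ; #bends               = λ _ → 0
    ; bends                = λ _ → []
    ; nodes-distinct       = λ { {inj₁ u} {inj₁ v} eq → ≡.cong inj₁ (position-injective eq) }
    ; vertices-avoid       = λ { v (e , zero) on → vertex-avoids v e on }
    ; segments-noncrossing = λ { {e , zero} {f , zero} σ≢τ p on-e on-f →
        noncrossing e f (λ e≡f → σ≢τ (≡.cong (_, zero) e≡f)) p on-e on-f }
    }
    where
    vertex-avoids : ∀ v e → OnSegment (position v) (position (src e) , position (tgt e)) →
                    IsEndOf (position v) (position (src e) , position (tgt e))
    vertex-avoids v e = ≡.subst (λ σ → OnSegment (position v) σ → IsEndOf (position v) σ) (≡.sym (edge-ends e)) λ on →
      case on-edge (decode e) on of λ where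
        (inj₁ end) → end
        (inj₂ int) → contradiction int (place-not-interior (coords v) (decode e))

    noncrossing : ∀ e f → e ≢ f → ∀ p → OnSegment p (position (src e) , position (tgt e)) →
                  OnSegment p (position (src f) , position (tgt f)) →
                  IsEndOf p (position (src e) , position (tgt e)) × IsEndOf p (position (src f) , position (tgt f))
    noncrossing e f e≢f p = ≡.subst₂ (λ σ τ → OnSegment p σ → OnSegment p τ → IsEndOf p σ × IsEndOf p τ)
      (≡.sym (edge-ends e)) (≡.sym (edge-ends f))
      (edges-noncrossing (decode e) (decode f) (λ eq → e≢f (decode-injective eq)) p)

-- The gap instance: its minimum bi-cut and its LP value.

module GapInstance {c ℓ₁ ℓ₂} (K : ArchimedeanOrderedField c ℓ₁ ℓ₂) (m : ℕ) where
  k : ℕ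
  k = suc m

  open ArchimedeanOrderedField K hiding (zero)
  open OrderedField K
  open Counting K
  open Grid k
  open Digraph grid hiding (#E)
  open Cuts K grid
  open import Algebra.Definitions.RawMonoid +-rawMonoid using () renaming (_×_ to _·_)
  open import Relation.Binary.Reasoning.PartialOrder (DecTotalOrder.poset decTotalOrder)

  -- In terms of `k = m + 1` these are `k`, `2k - 1` and `2k`. The last exceeds `opt`, so a bi-cut
  -- containing a single edge of weight `W` already satisfies the lower bound.
  κ opt W : Carrier
  κ   = k · 1#
  opt = κ + m · 1#
  W   = κ + κ

  weight : GridEdge → Carrier
  weight (diag _ _) = 1#
  weight (inj₂ _)   = W

  w : E → Carrier
  w e = weight (decode e)

  0≤κ : 0# ≤ κ
  0≤κ = n·1-nonneg k

  w≥0 : ∀ e → 0# ≤ w e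
  w≥0 e with decode e
  ... | diag _ _ = 0≤1
  ... | inj₂ _   = +-nonneg 0≤κ 0≤κ

  s t : V
  s = vertex (zero , fromℕ k)
  t = vertex (fromℕ k , zero)

  I : Instance K
  I = record { graph = grid ; w = w ; w≥0 = w≥0 ; s = s ; t = t ; s≢t = s≢t }
    where
    s≢t : s ≢ t
    s≢t s≡t with () ← vertex-injective {zero , fromℕ k} {fromℕ k , zero} s≡t

  heavy : Fin (k ℕ.* suc k ℕ.+ suc k ℕ.* k) → E
  heavy r = (k ℕ.* k) ↑ʳ r

  decode-heavy : ∀ r → ∃ λ h → decode (heavy r) ≡ inj₂ h
  decode-heavy r with splitAt (k ℕ.* k) ((k ℕ.* k) ↑ʳ r) | Fin.splitAt-↑ʳ (k ℕ.* k) _ r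
  ... | inj₂ _ | ≡.refl = _ , ≡.refl

  ∑-edges : (f : E → Carrier) →
            sum f ≈ (sum λ i → sum λ j → f (encode (diag i j))) + sum (λ r → f (heavy r))
  ∑-edges f = trans (∑-++ (k ℕ.* k) f)
    (+-congʳ (∑-combine k {k} (λ c → f (c ↑ˡ (k ℕ.* suc k ℕ.+ suc k ℕ.* k)))))

  module _ (C : E → Bool) where

    χ : Fin k → Fin k → Bool
    χ i j = C (encode (diag i j))

    weight-split : weightOf w C ≈ cells χ + sum (λ r → if C (heavy r) then w (heavy r) else 0#)
    weight-split = trans (∑-edges (λ e → if C e then w e else 0#))
      (+-congʳ (sum-cong-≋ λ i → sum-cong-≋ λ j →
        reflexive (≡.cong (λ z → if χ i j then z else 0#) (≡.cong weight (decode-encode (diag i j))))))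

    cells≤weight : cells χ ≤ weightOf w C
    cells≤weight = ≤-trans (x≤x+y (∑-nonneg λ r → if-nonneg (C (heavy r)) (w≥0 (heavy r)))) (≤-reflexive (sym weight-split))

    Light : Set
    Light = ∀ h → C (encode (inj₂ h)) ≡ false

    -- Comparing the total weight with `W` replaces a search for a heavy edge: any heavy edge in `C`
    -- alone contributes `W`.
    heavy-or-light : W ≤ weightOf w C ⊎ Light
    heavy-or-light with W ≤? weightOf w C
    ... | yes W≤ = inj₁ W≤
    ... | no  W≰ = inj₂ λ h → absent h (C (encode (inj₂ h))) ≡.refl
      where
      absent : ∀ h b → C (encode (inj₂ h)) ≡ b → b ≡ false
      absent h false _ = ≡.refl
      absent h true  p = contradiction (begin
        W
          ≡⟨ ≡.cong weight (decode-encode (inj₂ h)) ⟨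
        w (encode (inj₂ h))
          ≡⟨ ≡.cong (λ b → if b then w (encode (inj₂ h)) else 0#) p ⟨
        (if C (encode (inj₂ h)) then w (encode (inj₂ h)) else 0#)
          ≤⟨ term≤∑ {f = λ e → if C e then w e else 0#} (λ e → if-nonneg (C e) (w≥0 e)) (encode (inj₂ h)) ⟩
        weightOf w C ∎) W≰

    module _ {S : V → Bool} (S⊆C : ∀ e → leaves S e ≡ true → C e ≡ true) where

      leaves-encode : ∀ g → S (vertex (tail g)) ≡ true → S (vertex (head g)) ≡ false → C (encode g) ≡ true
      leaves-encode g p q = S⊆C (encode g)
        (≡.trans (≡.cong (λ h → S (vertex (tail h)) ∧ not (S (vertex (head h)))) (decode-encode g))
                 (≡.cong₂ (λ a b → a ∧ not b) p q))

      light-closed : Light → ∀ h → S (vertex (tail (inj₂ h))) ≡ true → S (vertex (head (inj₂ h))) ≡ true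
      light-closed light h p with S (vertex (head (inj₂ h))) in q
      ... | true  = ≡.refl
      ... | false = ≡.trans (≡.sym (light h)) (leaves-encode (inj₂ h) p q)

      staircase : Light → Staircase χ (λ i j → S (vertex (i , j)))
      staircase light = record
        { left-closed = λ i j → light-closed light (inj₁ (i , j))
        ; down-closed = λ i j → light-closed light (inj₂ (i , j))
        ; diag-cut    = λ i j → leaves-encode (diag i j)
        }

  st-cut-weight : ∀ {S} → Separates s t S → κ ≤ weightOf w (leaves S)
  st-cut-weight {S} (separates s∈S t∉S) with heavy-or-light (leaves S)
  ... | inj₁ W≤    = ≤-trans (x≤x+y 0≤κ) W≤
  ... | inj₂ light = ≤-trans
    (STCut.k≤cells (χ (leaves S)) (staircase (leaves S) {S} (λ e p → p) light) s∈S t∉S)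
    (cells≤weight (leaves S))

  opt≤bicut : ∀ E′ → IsBiCut s t E′ → opt ≤ cutWeight K I E′
  opt≤bicut E′ (st-disc , ts-disc) = bound (disconnected-cut st-disc) (disconnected-cut ts-disc) (heavy-or-light (lookup E′))
    where
    bound : (∃ λ S → Separates s t S × (∀ e → leaves S e ≡ true → e ∈ E′)) →
            (∃ λ T → Separates t s T × (∀ e → leaves T e ≡ true → e ∈ E′)) →
            W ≤ weightOf w (lookup E′) ⊎ Light (lookup E′) → opt ≤ weightOf w (lookup E′)
    bound _ _ (inj₁ W≤) = ≤-trans (+-mono-≤ ≤-refl (y≤x+y 0≤1)) W≤
    bound (S , separates s∈S t∉S , S⊆E′) (T , separates t∈T s∉T , T⊆E′) (inj₂ light) =
      ≤-trans (+-cancelʳ-≤ 1# opt+1≤cells+1) (cells≤weight (lookup E′))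
      where
      stairS : Staircase (χ (lookup E′)) (λ i j → S (vertex (i , j)))
      stairS = staircase (lookup E′) {S} (λ e p → []=⇒lookup (S⊆E′ e p)) light
      stairT : Staircase (χ (lookup E′)) (λ i j → T (vertex (i , j)))
      stairT = staircase (lookup E′) {T} (λ e p → []=⇒lookup (T⊆E′ e p)) light
      -- Adding 1 on both sides avoids subtraction: `opt + 1#` is `κ + κ`, the bound supplied by the
      -- count over both staircases.
      opt+1≤cells+1 : opt + 1# ≤ cells (χ (lookup E′)) + 1#
      opt+1≤cells+1 = begin
        (κ + m · 1#) + 1#  ≈⟨ +-assoc _ _ _ ⟩
        κ + (m · 1# + 1#)  ≈⟨ +-congˡ (+-comm _ _) ⟩
        κ + κ              ≤⟨ STCut.TSCut.2k≤cells+1 (χ (lookup E′)) stairS s∈S t∉S stairT t∈T s∉T ⟩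
        cells (χ (lookup E′)) + 1#  ∎

  -- An optimal bi-cut: the diagonals leaving the leftmost column, which contains `s`, and those
  -- leaving the bottom row, which contains `t`. The two families share the corner cell, which makes
  -- `2k - 1` edges.
  border : GridEdge → Bool
  border (diag i j) = isZero i ∨ isZero j
  border (inj₂ _)   = false

  borderCut : Subset #edges
  borderCut = tabulate (border ∘ decode)

  column₀ row₀ : V → Bool
  column₀ = isZero ∘ proj₁ ∘ coords
  row₀    = isZero ∘ proj₂ ∘ coords

  border-isBiCut : IsBiCut s t borderCut
  border-isBiCut =
    cut-disconnects {S = column₀}
      (separates (≡.cong (isZero ∘ proj₁) (coords-vertex (zero , fromℕ k)))
                 (≡.cong (isZero ∘ proj₁) (coords-vertex (fromℕ k , zero))))
      (λ e p → in-cut e (leaves-column₀ (decode e)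
        (≡.trans (≡.sym (≡.cong₂ (λ a b → isZero (proj₁ a) ∧ not (isZero (proj₁ b)))
          (coords-vertex (tail (decode e))) (coords-vertex (head (decode e))))) p))) ,
    cut-disconnects {S = row₀}
      (separates (≡.cong (isZero ∘ proj₂) (coords-vertex (fromℕ k , zero)))
                 (≡.cong (isZero ∘ proj₂) (coords-vertex (zero , fromℕ k))))
      (λ e p → in-cut e (leaves-row₀ (decode e)
        (≡.trans (≡.sym (≡.cong₂ (λ a b → isZero (proj₂ a) ∧ not (isZero (proj₂ b)))
          (coords-vertex (tail (decode e))) (coords-vertex (head (decode e))))) p)))
    where
    in-cut : ∀ e → border (decode e) ≡ true → e ∈ borderCut
    in-cut e p = lookup⇒[]= e borderCut (≡.trans (lookup∘tabulate (border ∘ decode) e) p)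

    leaves-column₀ : ∀ g → isZero (proj₁ (tail g)) ∧ not (isZero (proj₁ (head g))) ≡ true → border g ≡ true
    leaves-column₀ (diag zero j)    _ = ≡.refl
    leaves-column₀ (down zero j)    ()
    leaves-column₀ (down (suc i) j) ()

    leaves-row₀ : ∀ g → isZero (proj₂ (tail g)) ∧ not (isZero (proj₂ (head g))) ≡ true → border g ≡ true
    leaves-row₀ (diag i zero)    _ = ∨-zeroʳ (isZero i)
    leaves-row₀ (left i zero)    ()
    leaves-row₀ (left i (suc j)) ()

  ∑-1≈ : ∀ {n} (f : Fin n → Carrier) → (∀ i → f i ≈ 1#) → sum f ≈ n · 1#
  ∑-1≈ {zero}  f f≈1 = refl
  ∑-1≈ {suc n} f f≈1 = +-cong (f≈1 zero) (∑-1≈ (f ∘ suc) (f≈1 ∘ suc))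

  ∑-0≈ : ∀ {n} (f : Fin n → Carrier) → (∀ i → f i ≈ 0#) → sum f ≈ 0#
  ∑-0≈ {zero}  f f≈0 = refl
  ∑-0≈ {suc n} f f≈0 = trans (+-cong (f≈0 zero) (∑-0≈ (f ∘ suc) (f≈0 ∘ suc))) (+-identityˡ 0#)

  border-weight : cutWeight K I borderCut ≈ opt
  border-weight = begin-equality
    weightOf w (lookup borderCut)
      ≈⟨ sum-cong-≋ (λ e → reflexive (≡.cong (λ b → if b then w e else 0#) (lookup∘tabulate (border ∘ decode) e))) ⟩
    weightOf w (border ∘ decode)
      ≈⟨ weight-split (border ∘ decode) ⟩
    cells (χ (border ∘ decode)) + sum (λ r → if border (decode (heavy r)) then w (heavy r) else 0#)
      ≈⟨ +-cong cells≈ (∑-0≈ (λ r → if border (decode (heavy r)) then w (heavy r) else 0#) λ r →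
           reflexive (≡.cong (λ g → if border g then w (heavy r) else 0#) (proj₂ (decode-heavy r)))) ⟩
    opt + 0#
      ≈⟨ +-identityʳ opt ⟩
    opt ∎
    where
    cells≈ : cells (χ (border ∘ decode)) ≈ opt
    cells≈ = begin-equality
      cells (χ (border ∘ decode))
        ≈⟨ (sum-cong-≋ λ i → sum-cong-≋ λ j → reflexive (≡.cong (ind ∘ border) (decode-encode (diag i j)))) ⟩
      (sum λ (i : Fin k) → sum λ (j : Fin k) → ind (isZero i ∨ isZero j))
        -- Column 0 contributes `k` cells, and each of the other `m` columns only its cell in row 0.
        ≈⟨ +-cong (∑-1≈ {k} (λ _ → 1#) (λ _ → refl))
             (∑-1≈ {m} (λ _ → sum λ (j : Fin k) → ind (isZero j))
               (λ _ → trans (+-congˡ (∑-0≈ {m} (λ _ → 0#) (λ _ → refl))) (+-identityʳ 1#))) ⟩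
      opt ∎

  κ≉0 : ¬ (κ ≈ 0#)
  κ≉0 κ≈0 = 1≰0 (≤-trans (x≤x+y (n·1-nonneg m)) (≤-reflexive κ≈0))

  y : Carrier
  y = proj₁ (inverse κ κ≉0)

  κy≈1 : κ * y ≈ 1#
  κy≈1 = proj₂ (inverse κ κ≉0)

  0≤y : 0# ≤ y
  0≤y with total 0# y
  ... | inj₁ 0≤y = 0≤y
  ... | inj₂ y≤0 = contradiction (begin
    1#      ≈⟨ κy≈1 ⟨
    κ * y   ≤⟨ *-monoˡ-≤ 0≤κ y≤0 ⟩
    κ * 0#  ≈⟨ zeroʳ κ ⟩
    0#      ∎) 1≰0

  ξ : GridEdge → Carrier
  ξ (diag _ _) = y
  ξ (inj₂ _)   = 0#

  level : Fin (suc k) → Carrier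
  level i = toℕ i · y

  level-step : ∀ i → level (suc i) ≤ level (inject₁ i) + y
  level-step i = ≤-reflexive (trans (+-comm y _) (+-congʳ (reflexive (≡.cong (_· y) (≡.sym (Fin.toℕ-inject₁ i))))))

  level-mono : ∀ i → level (inject₁ i) ≤ level (suc i) + 0#
  level-mono i = ≤-trans (≤-reflexive (reflexive (≡.cong (_· y) (Fin.toℕ-inject₁ i))))
    (≤-trans (y≤x+y 0≤y) (≤-reflexive (sym (+-identityʳ _))))

  level-last : level (fromℕ k) ≈ 1#
  level-last = trans (reflexive (≡.cong (_· y) (Fin.toℕ-fromℕ k))) (trans (n·x≈n·1*x k y) κy≈1)

  ξ-potential : ∀ (π : Site → Fin (suc k)) → (∀ g → level (π (head g)) ≤ level (π (tail g)) + ξ g) →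
                Potential (ξ ∘ decode) (level ∘ π ∘ coords)
  ξ-potential π step e = ≡.subst₂ (λ p q → level (π q) ≤ level (π p) + ξ (decode e))
    (≡.sym (coords-vertex (tail (decode e)))) (≡.sym (coords-vertex (head (decode e)))) (step (decode e))

  -- A coordinate divided by `k` is a potential that rises from 0 to 1 along the walk. The first
  -- coordinate serves the walks from `s` to `t`, the second those from `t` to `s`.
  ξ-long : ∀ (π : Site → Fin (suc k)) → (∀ g → level (π (head g)) ≤ level (π (tail g)) + ξ g) →
           ∀ {a b} → π a ≡ zero → π b ≡ fromℕ k → (p : Walk (vertex a) (vertex b)) → 1# ≤ walkLength (ξ ∘ decode) p
  ξ-long π step {a} {b} πa πb p = begin
    1#                                      ≈⟨ level-last ⟨
    level (fromℕ k)                         ≡⟨ ≡.cong level (≡.trans (≡.cong π (coords-vertex b)) πb) ⟨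
    level (π (coords (vertex b)))           ≤⟨ potential-walk {ξ ∘ decode} {level ∘ π ∘ coords} (ξ-potential π step) p ⟩
    level (π (coords (vertex a))) + walkLength (ξ ∘ decode) p
                                            ≡⟨ ≡.cong (λ i → level i + walkLength (ξ ∘ decode) p) (≡.trans (≡.cong π (coords-vertex a)) πa) ⟩
    0# + walkLength (ξ ∘ decode) p          ≈⟨ +-identityˡ _ ⟩
    walkLength (ξ ∘ decode) p               ∎

  ξ-feasible : Feasible K I (ξ ∘ decode)
  ξ-feasible = nonneg ,
    (λ p _ → ξ-long proj₁ column-step {zero , fromℕ k} {fromℕ k , zero} ≡.refl ≡.refl p) ,
    (λ p _ → ξ-long proj₂ row-step {fromℕ k , zero} {zero , fromℕ k} ≡.refl ≡.refl p)
    where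
    nonneg : ∀ e → 0# ≤ ξ (decode e)
    nonneg e with decode e
    ... | diag _ _ = 0≤y
    ... | inj₂ _   = ≤-refl
    column-step : ∀ g → level (proj₁ (head g)) ≤ level (proj₁ (tail g)) + ξ g
    column-step (diag i j) = level-step i
    column-step (left i j) = level-mono i
    column-step (down i j) = x≤x+y ≤-refl
    row-step : ∀ g → level (proj₂ (head g)) ≤ level (proj₂ (tail g)) + ξ g
    row-step (diag i j) = level-step j
    row-step (left i j) = x≤x+y ≤-refl
    row-step (down i j) = level-mono j

  ξ-objective : objective K I (ξ ∘ decode) ≈ κ
  ξ-objective = begin-equality
    sum (λ e → weight (decode e) * ξ (decode e))
      ≈⟨ ∑-edges (λ e → weight (decode e) * ξ (decode e)) ⟩
    (sum λ i → sum λ j → cost (encode (diag i j))) + sum (λ r → cost (heavy r))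
      ≈⟨ +-cong (∑-1≈ {k} (λ i → sum λ j → cost (encode (diag i j))) row)
           (∑-0≈ (λ r → cost (heavy r)) λ r → trans (reflexive (≡.cong costᵍ (proj₂ (decode-heavy r)))) (zeroʳ W)) ⟩
    κ + 0#
      ≈⟨ +-identityʳ κ ⟩
    κ ∎
    where
    costᵍ : GridEdge → Carrier
    costᵍ g = weight g * ξ g
    cost : E → Carrier
    cost e = costᵍ (decode e)
    row : ∀ i → (sum λ j → cost (encode (diag i j))) ≈ 1#
    row i = begin-equality
      (sum λ j → cost (encode (diag i j)))
        ≈⟨ (sum-cong-≋ λ j → trans (reflexive (≡.cong costᵍ (decode-encode (diag i j)))) (*-identityˡ y)) ⟩
      sum {k} (λ _ → y)
        ≈⟨ sum-replicate k ⟩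
      k · y
        ≈⟨ n·x≈n·1*x k y ⟩
      κ * y
        ≈⟨ κy≈1 ⟩
      1# ∎

  -- Rounding in the direction from `s` to `t` gives a cut that weighs no more than the objective,
  -- and every such cut weighs at least `κ`.
  κ≤objective : ∀ {x} → (∀ e → 0# ≤ x e) → ((p : Walk s t) → IsPath p → 1# ≤ walkLength x p) →
                κ ≤ sum (λ e → w e * x e)
  κ≤objective {x} 0≤x long = bound (fractional-to-cut {w} w≥0 {x} {s} {t} 0≤x long)
    where
    bound : (∃ λ S → Separates s t S × weightOf w (leaves S) ≤ sum (λ e → w e * x e)) → κ ≤ sum (λ e → w e * x e)
    bound (S , S-sep , S-light) = ≤-trans (st-cut-weight {S} S-sep) S-light

  isLPValue : IsLPValue K I κ
  isLPValue = (ξ ∘ decode , ξ-feasible , ξ-objective) , λ x (0≤x , st-long , _) → κ≤objective {x} 0≤x st-long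

  isMinBiCutWeight : IsMinBiCutWeight K I opt
  isMinBiCutWeight = (borderCut , border-isBiCut , border-weight) , opt≤bicut

  0<κ : 0# < κ
  0<κ = 0≤κ , λ 0≈κ → κ≉0 (sym 0≈κ)

  -- Since `opt` is `2κ - 1`, the missing 1 is covered by `δ * κ`.
  gap : ∀ {δ} → 1# ≤ δ * κ → (2# - δ) * κ ≤ opt
  gap {δ} 1≤δκ = +-cancelʳ-≤ 1# (begin
    (2# - δ) * κ + 1#           ≤⟨ +-mono-≤ ≤-refl 1≤δκ ⟩
    (2# - δ) * κ + δ * κ        ≈⟨ distribʳ κ _ _ ⟨
    ((2# - δ) + δ) * κ          ≈⟨ *-congʳ (x-y+y≈x 2# δ) ⟩
    2# * κ                      ≈⟨ distribʳ κ 1# 1# ⟩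
    1# * κ + 1# * κ             ≈⟨ +-cong (*-identityˡ κ) (*-identityˡ κ) ⟩
    κ + (1# + m · 1#)           ≈⟨ +-congˡ (+-comm _ _) ⟩
    κ + (m · 1# + 1#)           ≈⟨ +-assoc _ _ _ ⟨
    opt + 1#                    ∎)

-- Choice of the grid size and conclusion.

module _ {c ℓ₁ ℓ₂} (K : ArchimedeanOrderedField c ℓ₁ ℓ₂) where
  open ArchimedeanOrderedField K hiding (zero)
  open OrderedField K
  open import Algebra.Definitions.RawMonoid +-rawMonoid using () renaming (_×_ to _·_)
  open import Relation.Binary.Reasoning.PartialOrder (DecTotalOrder.poset decTotalOrder)

  -- Chooses the grid size: the Archimedean property bounds the inverse of `δ` by some `m`, and
  -- `suc m` keeps the grid nondegenerate.
  reciprocal-bound : ∀ {δ} → 0# < δ → ∃ λ m → 1# ≤ δ * (suc m · 1#)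
  reciprocal-bound {δ} (0≤δ , 0≉δ) =
    let y , δy≈1 = inverse δ (λ δ≈0 → 0≉δ (sym δ≈0))
        m , y≤m  = archimedean y
    in m , (begin
      1#                ≈⟨ δy≈1 ⟨
      δ * y             ≤⟨ *-monoˡ-≤ 0≤δ (≤-trans y≤m (y≤x+y 0≤1)) ⟩
      δ * (suc m · 1#)  ∎)

mainTheorem6 : ∀ {c ℓ₁ ℓ₂} (K : ArchimedeanOrderedField c ℓ₁ ℓ₂) →
    let open ArchimedeanOrderedField K in
    (∀ (I : Instance K) (opt lp : Carrier) →
    IsMinBiCutWeight K I opt → IsLPValue K I lp → opt ≤ 2# * lp)
    ×
    (∀ (ε : Carrier) → 0# < ε →
    Σ (Instance K) λ I → Planar (Instance.graph I) ×
    ∃ λ (opt : Carrier) → ∃ λ (lp : Carrier) →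
    IsMinBiCutWeight K I opt × IsLPValue K I lp ×
    0# < lp × (2# - ε) * lp ≤ opt)
mainTheorem6 K =
  (λ I opt lp → Rounding.bicut≤2lp K I) ,
  λ δ 0<δ →
    let m , 1≤δκ = reciprocal-bound K 0<δ
        open GapInstance K m
    in I , GridDrawing.grid-planar (suc m) , opt , κ , isMinBiCutWeight , isLPValue , 0<κ , gap 1≤δκ
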